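{- For every integer $n\ge 1$ the following congruences hold: (i) $12\tau(n) \equiv 5n\sigma_3(n)+7n\sigma_5(n) \pmod{2^3\cdot 3\cdot 5\cdot 7}$; (ii) $32\tau(n) \equiv 15n\sigma(n)+ 50n^2\sigma_7(n)-33n\sigma_9(n) \pmod{2^5\cdot 3^2\cdot 5^2}$; (iii) $7\tau(n) \equiv 6n^2\sigma(n)- 9n^3\sigma_5(n) + 10 n^2\sigma_7(n) \pmod{2^4\cdot 3^3\cdot 7}$; (iv) $5\tau(n) \equiv 14 n^3\sigma(n)+ 12 n^4\sigma_3(n)- 21 n^3\sigma_5(n) \pmod{2^5\cdot 3\cdot 5\cdot 7}$; (v) $24\tau(n) \equiv 10 n\sigma(n)+ 25 n\sigma_7(n)- 11 n\sigma_9(n) \pmod{2^3\cdot 3\cdot 5^2}$; (vi) $14\tau(n) \equiv 9 n^2\sigma(n)+ 5 n^2\sigma_7(n) \pmod{2^3\cdot 3^3\cdot 7}$; (vii) $5\tau(n) \equiv 8 n^3\sigma(n)- 3 n^3\sigma_5(n) \pmod{2^5\cdot 3\cdot 5}$; (viii) $2\tau(n) \equiv n^2\sigma(n)+ n^2\sigma_5(n) \pmod{2^3\cdot 3}$.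
   Context: $\tau(n)$ is Ramanujan's tau function, defined by $q\prod_{n\ge 1}(1-q^n)^{24} = \sum_{n\ge 1}\tau(n)q^n$. For $k\ge 1$, $\sigma_k(n)=\sum_{d\mid n} d^k$ (sum over positive divisors of $n$), and $\sigma(n)=\sigma_1(n)$. -}

module Defs where

open import Data.Bool.Base using (if_then_else_)
open import Data.Fin.Base using (toℕ; zero; suc)
open import Data.Integer.Base using (ℤ; +_; 0ℤ; 1ℤ; _+_; _-_; _*_)
open import Data.Integer.Divisibility.Signed using (_∣_)
open import Data.Integer.Properties
  using (+-0-commutativeMonoid; +-identityʳ; *-identityˡ; *-zeroˡ)
open import Data.List.Base using (List; applyUpTo; filter; map)
open import Data.Nat.Base as ℕ using (ℕ; zero; suc; _∸_; _≤_; _<_; z≤n; s≤s)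
import Data.Nat.Divisibility as ℕ using (_∣?_)
import Data.Nat.ListAction as ℕ using (sum)
import Data.Nat.Properties as ℕ
open import Relation.Binary.PropositionalEquality
  using (_≡_; refl; trans; cong; cong₂; module ≡-Reasoning)
open import Relation.Nullary.Decidable using (does; dec-false)
open import Algebra.Properties.CommutativeMonoid.Sum +-0-commutativeMonoid
  using (sum; sum⁺-syntax; sum-cong-≗; sum-replicate-zero)

infix 4 _≡_[mod_]

_≡_[mod_] : ℤ → ℤ → ℕ → Set
a ≡ b [mod m ] = + m ∣ a - b

-- Starting the range at 1 keeps 0 out of the divisors of 0.
divisors : ℕ → List ℕ
divisors n = filter (ℕ._∣? n) (applyUpTo suc n)

σ : ℕ → ℕ → ℕ
σ k n = ℕ.sum (map (ℕ._^ k) (divisors n))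

-- Formal power series in q over ℤ: f m is the coefficient of q^m.
Series : Set
Series = ℕ → ℤ

infixl 6 _⊖_
infixl 7 _⊛_
infixr 8 _^ˢ_

q^_ : ℕ → Series
(q^ n) m = if does (m ℕ.≟ n) then 1ℤ else 0ℤ

1ˢ : Series
1ˢ = q^ 0

_⊖_ : Series → Series → Series
(f ⊖ g) m = f m - g m

_⊛_ : Series → Series → Series
(f ⊛ g) m = ∑[ i ≤ m ] (f (toℕ i) * g (m ∸ toℕ i))

_^ˢ_ : Series → ℕ → Series
f ^ˢ zero  = 1ˢ
f ^ˢ suc k = f ⊛ f ^ˢ k

∏[1⋯_] : ℕ → (ℕ → Series) → Series
∏[1⋯ zero  ] F = 1ˢ
∏[1⋯ suc N ] F = F (suc N) ⊛ ∏[1⋯ N ] F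

-- The product of F n over all n ≥ 1, for families with F n ≡ 1 mod q^n:
-- then the coefficient of q^m is the same in every partial product with
-- at least m factors (∏∞-limit below), so the m-th one may be used.
∏∞ : (ℕ → Series) → Series
∏∞ F m = ∏[1⋯ m ] F m

eulerFactor²⁴ : ℕ → Series
eulerFactor²⁴ n = (1ˢ ⊖ q^ n) ^ˢ 24

Δ : Series
Δ = q^ 1 ⊛ ∏∞ eulerFactor²⁴

τ : ℕ → ℤ
τ n = Δ n

OneMod-q^ : ℕ → Series → Set
OneMod-q^ n f = ∀ {m} → m < n → f m ≡ 1ˢ m

⊛-OneMod : ∀ {n f} → OneMod-q^ n f → ∀ g {m} → m < n → (f ⊛ g) m ≡ g m
⊛-OneMod {n} {f} f≡1 g {m} m<n = begin
  f 0 * g m + sum {m} (λ i → f (suc (toℕ i)) * g (m ∸ suc (toℕ i)))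
    ≡⟨ cong₂ _+_ head≡ tail≡ ⟩
  g m + 0ℤ
    ≡⟨ +-identityʳ (g m) ⟩
  g m ∎
  where
  open ≡-Reasoning
  open import Data.Fin.Properties using (toℕ<n)

  head≡ : f 0 * g m ≡ g m
  head≡ = trans (cong (_* g m) (f≡1 (ℕ.≤-<-trans z≤n m<n))) (*-identityˡ (g m))

  tail≡ : sum {m} (λ i → f (suc (toℕ i)) * g (m ∸ suc (toℕ i))) ≡ 0ℤ
  tail≡ = trans
    (sum-cong-≗ {m} (λ i → trans
      (cong (_* g (m ∸ suc (toℕ i))) (f≡1 (ℕ.≤-<-trans (toℕ<n i) m<n)))
      (*-zeroˡ (g (m ∸ suc (toℕ i))))))
    (sum-replicate-zero m)

^ˢ-OneMod : ∀ {n f} → OneMod-q^ n f → ∀ k → OneMod-q^ n (f ^ˢ k)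
^ˢ-OneMod         f≡1 zero    m<n = refl
^ˢ-OneMod {f = f} f≡1 (suc k) m<n =
  trans (⊛-OneMod {f = f} f≡1 (f ^ˢ k) m<n) (^ˢ-OneMod {f = f} f≡1 k m<n)

eulerFactor²⁴-OneMod : ∀ n → OneMod-q^ n (eulerFactor²⁴ n)
eulerFactor²⁴-OneMod n {m} m<n = ^ˢ-OneMod {n} {1ˢ ⊖ q^ n} (λ {m} → base {m}) 24 {m} m<n
  where
  base : OneMod-q^ n (1ˢ ⊖ q^ n)
  base {m} m<n rewrite dec-false (m ℕ.≟ n) (ℕ.<⇒≢ m<n) = +-identityʳ (1ˢ m)

∏∞-limit : ∀ F → (∀ n → OneMod-q^ n (F n)) →
           ∀ {m N} → m ≤ N → ∏[1⋯ N ] F m ≡ ∏∞ F m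
∏∞-limit F F≡1 {m} {N} m≤N = go (ℕ.≤⇒≤′ m≤N)
  where
  go : ∀ {N} → m ℕ.≤′ N → ∏[1⋯ N ] F m ≡ ∏∞ F m
  go ℕ.≤′-refl             = refl
  go (ℕ.≤′-step {N} m≤′N) =
    trans (⊛-OneMod {f = F (suc N)} (F≡1 (suc N)) (∏[1⋯ N ] F) (s≤s (ℕ.≤′⇒≤ m≤′N))) (go m≤′N)

{-# OPTIONS --safe #-}

-- With σₖ(0) = 0, write Sₖ = Σ σₖ(n) qⁿ and θ = q d/dq, so that θ multiplies
-- the n-th coefficient by n. For g_a = qᵃ / (1 - qᵃ) one has
-- Sₖ = Σ_a aᵏ g_a and g_a g_b = g_{a+b} g_a + g_{a+b} g_b + g_{a+b}.
-- Let h be a symmetric polynomial with h(a+b, a) = h(a+b, b). Summing the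
-- product formula against h(a+b, a), and splitting Σ h(a, b) g_a g_b along
-- the diagonal, gives
--   Σ_{a,b} (h(a+b, a) - h(a, b)) g_a g_b
--     = Σ_a (Σ_{b<a} h(a, b)) g_a - Σ_a h(a, a) g_a².
-- Here a g_a² = θ g_a - a g_a, the sum over b is a Faulhaber polynomial, and
-- h(a+b, a) = h(a, -b) shows that h(a+b, a) - h(a, b) has odd exponents only,
-- so this is a relation between SₖSₗ, θSₖ and Sₖ. The invariants generated by
-- a² - ab + b² and (ab(a - b))² give Ramanujan's differential equations for
-- E₂, E₄, E₆ together with E₈ = E₄² and E₁₀ = E₄E₆. Both E₄³ - E₆² and the
-- product Δ satisfy θf = E₂f, whence 1728 Δ = E₄³ - E₆². Each congruence is
-- then the reduction of an identity, integral in the coefficients, between Δ,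
-- the θʲSₖ and the products θⁱSₖ θʲSₗ, which becomes an identity of
-- polynomials in S₁, S₃, S₅.

module Submission where

open import Algebra.Bundles using (CommutativeRing)
open import Algebra.Structures using (IsCommutativeRing)
import Algebra.Properties.Semiring.Sum as SemiringSum
import Algebra.Solver.Ring as RingSolver
open import Algebra.Solver.Ring.AlmostCommutativeRing
  using (fromCommutativeRing; _-Raw-AlmostCommutative⟶_)
open import Data.Bool.Base using (true; false; if_then_else_)
open import Data.Fin.Base using (Fin; toℕ)
open import Data.Fin.Patterns using (0F; 1F; 2F; 3F; 4F)
open import Data.Fin.Properties using (toℕ≤pred[n])
open import Data.Integer.Base as ℤ using (ℤ; +_; 0ℤ; 1ℤ; -1ℤ; _+_; _-_; _*_; -_; _^_)
open import Data.Integer.Divisibility.Signed using (divides)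
import Data.Integer.Properties as ℤ
open import Data.Integer.Solver using (module +-*-Solver)
open import Data.List.Base using (List; []; _∷_; map; filter; applyUpTo)
open import Data.Maybe.Base using (Maybe; just; nothing)
open import Data.Nat.Base as ℕ using (ℕ; zero; suc; _≥_; _≤_; _<_; z≤n; s≤s; _∸_)
open import Data.Nat.Divisibility as ℕ using (_∣?_)
import Data.Nat.ListAction as ℕ using (sum)
import Data.Nat.Properties as ℕ
open import Data.Product.Base using (_×_; _,_)
open import Data.Vec.Base using ([]; _∷_; lookup)
open import Function.Base using (flip; _∘_)
open import Level using (0ℓ)
open import Relation.Binary.PropositionalEquality
import Relation.Binary.Reasoning.Setoid as SetoidReasoning
open import Relation.Nullary using (¬_; yes; no; does)
open import Relation.Nullary.Decidable using (dec-true; dec-false)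

open import Defs

open SemiringSum ℤ.+-*-semiring
  using (sum; sum-cong-≗; ∑-distrib-+; ∑-comm; *-distribˡ-sum; sum-replicate-zero)

-- The ring of power series with its derivation θ

infixl 6 _⊕_
infixl 7 _·_

_⊕_ : Series → Series → Series
(f ⊕ g) m = f m + g m

⊝_ : Series → Series
(⊝ f) m = - f m

0ˢ : Series
0ˢ _ = 0ℤ

_·_ : ℤ → Series → Series
(c · f) m = c * f m

tail : Series → Series
tail f m = f (suc m)

-- Coefficient `m` of a product depends only on coefficients up to `m`. This is what allows `σˢ` and
-- `∏∞` to be replaced by finite truncations below.
⊛-cong-≤ : ∀ {f f′ g g′} m → (∀ i → i ≤ m → f i ≡ f′ i) → (∀ i → i ≤ m → g i ≡ g′ i) →
           (f ⊛ g) m ≡ (f′ ⊛ g′) m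
⊛-cong-≤ zero    f≡ g≡ = cong (_+ 0ℤ) (cong₂ _*_ (f≡ 0 z≤n) (g≡ 0 z≤n))
⊛-cong-≤ (suc m) f≡ g≡ =
  cong₂ _+_ (cong₂ _*_ (f≡ 0 z≤n) (g≡ (suc m) ℕ.≤-refl))
            (⊛-cong-≤ m (λ i i≤m → f≡ (suc i) (s≤s i≤m)) (λ i i≤m → g≡ i (ℕ.m≤n⇒m≤1+n i≤m)))

⊛-cong : ∀ {f f′ g g′} → f ≗ f′ → g ≗ g′ → f ⊛ g ≗ f′ ⊛ g′
⊛-cong f≗ g≗ m = ⊛-cong-≤ m (λ i _ → f≗ i) (λ i _ → g≗ i)

⊛-zeroˡ : ∀ g → 0ˢ ⊛ g ≗ 0ˢ
⊛-zeroˡ g m = sum-replicate-zero (suc m)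

⊛-distribʳ : ∀ g f f′ → (f ⊕ f′) ⊛ g ≗ f ⊛ g ⊕ f′ ⊛ g
⊛-distribʳ g f f′ m = trans
  (sum-cong-≗ {suc m} (λ i → ℤ.*-distribʳ-+ (g (m ∸ toℕ i)) (f (toℕ i)) (f′ (toℕ i))))
  (∑-distrib-+ {suc m} (λ i → f (toℕ i) * g (m ∸ toℕ i)) (λ i → f′ (toℕ i) * g (m ∸ toℕ i)))

·-⊛ : ∀ c f g → (c · f) ⊛ g ≗ c · (f ⊛ g)
·-⊛ c f g m = trans
  (sum-cong-≗ {suc m} (λ i → ℤ.*-assoc c (f (toℕ i)) (g (m ∸ toℕ i))))
  (sym (*-distribˡ-sum {suc m} c (λ i → f (toℕ i) * g (m ∸ toℕ i))))

-- Peeling the constant coefficient off the left factor of `⊛` is definitional. This is the mirror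
-- image for the right factor, on which commutativity rests.
tail-⊛ʳ : ∀ f g → tail (f ⊛ g) ≗ f ⊛ tail g ⊕ g 0 · tail f
tail-⊛ʳ f g zero = trans (cong (λ x → f 0 * g 1 + (x + 0ℤ)) (ℤ.*-comm (f 1) (g 0)))
  (solve 2 (λ x y → x :+ (y :+ con 0ℤ) := x :+ con 0ℤ :+ y) refl (f 0 * g 1) (g 0 * f 1))
  where open +-*-Solver
tail-⊛ʳ f g (suc m) = trans (cong (λ x → f 0 * g (suc (suc m)) + x) (tail-⊛ʳ (tail f) g m))
  (sym (ℤ.+-assoc (f 0 * g (suc (suc m))) ((tail f ⊛ tail g) m) (g 0 * tail (tail f) m)))

⊛-comm : ∀ f g → f ⊛ g ≗ g ⊛ f
⊛-comm f g zero    = cong (_+ 0ℤ) (ℤ.*-comm (f 0) (g 0))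
⊛-comm f g (suc m) = trans
  (cong (λ x → f 0 * g (suc m) + x) (⊛-comm (tail f) g m))
  (trans (ℤ.+-comm (f 0 * g (suc m)) ((g ⊛ tail f) m)) (sym (tail-⊛ʳ g f m)))

⊛-assoc : ∀ f g h → (f ⊛ g) ⊛ h ≗ f ⊛ (g ⊛ h)
⊛-assoc f g h zero = solve 3
  (λ x y z → (x :* y :+ con 0ℤ) :* z :+ con 0ℤ := x :* (y :* z :+ con 0ℤ) :+ con 0ℤ)
  refl (f 0) (g 0) (h 0)
  where open +-*-Solver
⊛-assoc f g h (suc m) = begin
  (f 0 * g 0 + 0ℤ) * h (suc m) + ((f 0 · tail g ⊕ tail f ⊛ g) ⊛ h) m
    ≡⟨ cong (λ x → (f 0 * g 0 + 0ℤ) * h (suc m) + x)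
         (trans (⊛-distribʳ h (f 0 · tail g) (tail f ⊛ g) m)
                (cong₂ _+_ (·-⊛ (f 0) (tail g) h m) (⊛-assoc (tail f) g h m))) ⟩
  (f 0 * g 0 + 0ℤ) * h (suc m) + (f 0 * (tail g ⊛ h) m + (tail f ⊛ (g ⊛ h)) m)
    ≡⟨ solve 5 (λ x y z u v → (x :* y :+ con 0ℤ) :* z :+ (x :* u :+ v)
                           := x :* (y :* z :+ u) :+ v)
         refl (f 0) (g 0) (h (suc m)) ((tail g ⊛ h) m) ((tail f ⊛ (g ⊛ h)) m) ⟩
  f 0 * (g 0 * h (suc m) + (tail g ⊛ h) m) + (tail f ⊛ (g ⊛ h)) m ∎
  where
  open ≡-Reasoning
  open +-*-Solver

⊛-identityˡ : ∀ f → 1ˢ ⊛ f ≗ f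
⊛-identityˡ f zero    = trans (ℤ.+-identityʳ (1ℤ * f 0)) (ℤ.*-identityˡ (f 0))
⊛-identityˡ f (suc m) = trans
  (cong₂ _+_ (ℤ.*-identityˡ (f (suc m))) (⊛-zeroˡ f m)) (ℤ.+-identityʳ (f (suc m)))

⊛-isCommutativeRing : IsCommutativeRing _≗_ _⊕_ _⊛_ ⊝_ 0ˢ 1ˢ
⊛-isCommutativeRing = record
  { isRing = record
    { +-isAbelianGroup = record
      { isGroup = record
        { isMonoid = record
          { isSemigroup = record
            { isMagma = record
              { isEquivalence = record
                { refl  = λ _ → refl
                ; sym   = λ f≗g m → sym (f≗g m)
                ; trans = λ f≗g g≗h m → trans (f≗g m) (g≗h m)
                }
              ; ∙-cong = λ f≗ g≗ m → cong₂ _+_ (f≗ m) (g≗ m)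
              }
            ; assoc = λ f g h m → ℤ.+-assoc (f m) (g m) (h m)
            }
          ; identity = (λ f m → ℤ.+-identityˡ (f m)) , (λ f m → ℤ.+-identityʳ (f m))
          }
        ; inverse = (λ f m → ℤ.+-inverseˡ (f m)) , (λ f m → ℤ.+-inverseʳ (f m))
        ; ⁻¹-cong = λ f≗ m → cong -_ (f≗ m)
        }
      ; comm = λ f g m → ℤ.+-comm (f m) (g m)
      }
    ; *-cong     = ⊛-cong
    ; *-assoc    = ⊛-assoc
    ; *-identity = ⊛-identityˡ , λ f m → trans (⊛-comm f 1ˢ m) (⊛-identityˡ f m)
    ; distrib    = (λ f g h m → trans (⊛-comm f (g ⊕ h) m)
                      (trans (⊛-distribʳ f g h m) (cong₂ _+_ (⊛-comm g f m) (⊛-comm h f m))))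
                 , ⊛-distribʳ
    }
  ; *-comm = ⊛-comm
  }

seriesRing : CommutativeRing 0ℓ 0ℓ
seriesRing = record { isCommutativeRing = ⊛-isCommutativeRing }

module S = CommutativeRing seriesRing

const : ℤ → Series
const c = c · 1ˢ

const-⊛ : ∀ c f → const c ⊛ f ≗ c · f
const-⊛ c f m = trans (·-⊛ c 1ˢ f m) (cong (c *_) (⊛-identityˡ f m))

-- Integers enter as constant series, so that solver expressions may contain numerals. `con 1ℤ`
-- denotes `const 1ℤ`, which equals `1ˢ` pointwise but not by definition; hence the conversions
-- between the two later on.
const-homomorphism :
  CommutativeRing.rawRing ℤ.+-*-commutativeRing -Raw-AlmostCommutative⟶ fromCommutativeRing seriesRing
const-homomorphism = record
  { ⟦_⟧    = const
  ; +-homo = λ c d m → ℤ.*-distribʳ-+ (1ˢ m) c d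
  ; *-homo = λ c d m → trans (ℤ.*-assoc c d (1ˢ m)) (sym (const-⊛ c (const d) m))
  ; -‿homo = λ c m → sym (ℤ.neg-distribˡ-* c (1ˢ m))
  ; 0-homo = λ m → ℤ.*-zeroˡ (1ˢ m)
  ; 1-homo = λ m → ℤ.*-identityˡ (1ˢ m)
  }

const-≟ : ∀ c d → Maybe (const c ≗ const d)
const-≟ c d with c ℤ.≟ d
... | yes c≡d = just (λ m → cong (λ c → const c m) c≡d)
... | no  _   = nothing

module SeriesSolver = RingSolver
  (CommutativeRing.rawRing ℤ.+-*-commutativeRing) (fromCommutativeRing seriesRing)
  const-homomorphism const-≟

θ : Series → Series
θ f m = + m * f m

θ-cong : ∀ {f g} → f ≗ g → θ f ≗ θ g
θ-cong f≗g m = cong (+ m *_) (f≗g m)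

θ-⊕ : ∀ f g → θ (f ⊕ g) ≗ θ f ⊕ θ g
θ-⊕ f g m = ℤ.*-distribˡ-+ (+ m) (f m) (g m)

θ-⊝ : ∀ f → θ (⊝ f) ≗ ⊝ θ f
θ-⊝ f m = sym (ℤ.neg-distribʳ-* (+ m) (f m))

θ-const : ∀ c → θ (const c) ≗ 0ˢ
θ-const c zero    = refl
θ-const c (suc m) = trans (cong (+ suc m *_) (ℤ.*-zeroʳ c)) (ℤ.*-zeroʳ (+ suc m))

-- The weight `m` splits as `i + (m ∸ i)` in the term of index `i`.
θ-⊛ : ∀ f g → θ (f ⊛ g) ≗ θ f ⊛ g ⊕ f ⊛ θ g
θ-⊛ f g m = trans
  (*-distribˡ-sum {suc m} (+ m) (λ i → f (toℕ i) * g (m ∸ toℕ i)))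
  (trans (sum-cong-≗ {suc m} term)
         (∑-distrib-+ {suc m} (λ i → + toℕ i * f (toℕ i) * g (m ∸ toℕ i))
                              (λ i → f (toℕ i) * (+ (m ∸ toℕ i) * g (m ∸ toℕ i)))))
  where
  term : ∀ (i : Fin (suc m)) →
         + m * (f (toℕ i) * g (m ∸ toℕ i)) ≡
         + toℕ i * f (toℕ i) * g (m ∸ toℕ i) + f (toℕ i) * (+ (m ∸ toℕ i) * g (m ∸ toℕ i))
  term i = trans
    (cong (λ x → + x * (f (toℕ i) * g (m ∸ toℕ i))) (sym (ℕ.m+[n∸m]≡n (toℕ≤pred[n] i))))
    (solve 4 (λ x y u v → (x :+ y) :* (u :* v) := x :* u :* v :+ u :* (y :* v))
       refl (+ toℕ i) (+ (m ∸ toℕ i)) (f (toℕ i)) (g (m ∸ toℕ i)))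
    where open +-*-Solver

-- Finite sums

Σ< : ℕ → (ℕ → ℤ) → ℤ
Σ< n f = sum {n} (λ i → f (toℕ i))

Σ-cong : ∀ n {f g} → f ≗ g → Σ< n f ≡ Σ< n g
Σ-cong n f≗g = sum-cong-≗ {n} (λ i → f≗g (toℕ i))

Σ-0 : ∀ n {f} → f ≗ 0ˢ → Σ< n f ≡ 0ℤ
Σ-0 n f≗0 = trans (Σ-cong n f≗0) (sum-replicate-zero n)

Σ-+ : ∀ n f g → Σ< n (f ⊕ g) ≡ Σ< n f + Σ< n g
Σ-+ n f g = ∑-distrib-+ {n} (λ i → f (toℕ i)) (λ i → g (toℕ i))

Σ-· : ∀ n c f → c * Σ< n f ≡ Σ< n (c · f)
Σ-· n c f = *-distribˡ-sum {n} c (λ i → f (toℕ i))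

Σ-comm : ∀ m n (F : ℕ → ℕ → ℤ) → Σ< m (λ i → Σ< n (F i)) ≡ Σ< n (λ j → Σ< m (λ i → F i j))
Σ-comm m n F = ∑-comm {m} {n} (λ i j → F (toℕ i) (toℕ j))

Σ-last : ∀ n f → Σ< (suc n) f ≡ Σ< n f + f n
Σ-last zero    f = ℤ.+-comm (f 0) 0ℤ
Σ-last (suc n) f = trans (cong (λ x → f 0 + x) (Σ-last n (tail f)))
                         (sym (ℤ.+-assoc (f 0) (Σ< n (tail f)) (f (suc n))))

Σ-∸ : ∀ n f g → Σ< n f - Σ< n g ≡ Σ< n (f ⊖ g)
Σ-∸ n f g = begin
  Σ< n f - Σ< n g                       ≡⟨ cong (λ x → Σ< n f + x) (sym (ℤ.-1*i≡-i (Σ< n g))) ⟩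
  Σ< n f + -1ℤ * Σ< n g                ≡⟨ cong (λ x → Σ< n f + x) (Σ-· n -1ℤ g) ⟩
  Σ< n f + Σ< n (-1ℤ · g)              ≡⟨ Σ-+ n f (-1ℤ · g) ⟨
  Σ< n (f ⊕ -1ℤ · g)                   ≡⟨ Σ-cong n (λ i → cong (λ x → f i + x) (ℤ.-1*i≡-i (g i))) ⟩
  Σ< n (f ⊖ g)                          ∎
  where open ≡-Reasoning

ΣΣ< : ℕ → (ℕ → ℕ → ℤ) → ℤ
ΣΣ< n F = Σ< n (λ i → Σ< n (F i))

ΣΣ-cong : ∀ n {F G} → (∀ i j → F i j ≡ G i j) → ΣΣ< n F ≡ ΣΣ< n G
ΣΣ-cong n F≡G = Σ-cong n (λ i → Σ-cong n (F≡G i))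

ΣΣ-+ : ∀ n F G → ΣΣ< n (λ i j → F i j + G i j) ≡ ΣΣ< n F + ΣΣ< n G
ΣΣ-+ n F G = trans (Σ-cong n (λ i → Σ-+ n (F i) (G i))) (Σ-+ n (λ i → Σ< n (F i)) (λ i → Σ< n (G i)))

ΣΣ-· : ∀ n c F → c * ΣΣ< n F ≡ ΣΣ< n (λ i j → c * F i j)
ΣΣ-· n c F = trans (Σ-· n c (λ i → Σ< n (F i))) (Σ-cong n (λ i → Σ-· n c (F i)))

ΣΣ-∸ : ∀ n F G → ΣΣ< n F - ΣΣ< n G ≡ ΣΣ< n (λ i j → F i j - G i j)
ΣΣ-∸ n F G = trans (Σ-∸ n (λ i → Σ< n (F i)) (λ i → Σ< n (G i))) (Σ-cong n (λ i → Σ-∸ n (F i) (G i)))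

Σ-below-diagonal : ℕ → (ℕ → ℕ → ℤ) → ℤ
Σ-below-diagonal n F = Σ< n (λ i → Σ< i (F i))

-- Induction removes the first row and the first column, which extend the upper and the lower
-- triangle respectively.
Σ-square : ∀ n F → ΣΣ< n F ≡
  Σ< n (λ i → F i i) + (Σ-below-diagonal n F + Σ-below-diagonal n (flip F))
Σ-square zero    F = refl
Σ-square (suc n) F = begin
  F 0 0 + row + Σ< n (λ i → F (suc i) 0 + Σ< n (F′ i))
    ≡⟨ cong (λ x → F 0 0 + row + x) (Σ-+ n (λ i → F (suc i) 0) (λ i → Σ< n (F′ i))) ⟩
  F 0 0 + row + (column + ΣΣ< n F′)
    ≡⟨ cong (λ x → F 0 0 + row + (column + x)) (Σ-square n F′) ⟩
  F 0 0 + row + (column + (diagonal + (lower + upper)))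
    ≡⟨ solve 6 (λ a r c d l u → a :+ r :+ (c :+ (d :+ (l :+ u)))
          := a :+ d :+ (con 0ℤ :+ (c :+ l) :+ (con 0ℤ :+ (r :+ u))))
         refl (F 0 0) row column diagonal lower upper ⟩
  F 0 0 + diagonal + (0ℤ + (column + lower) + (0ℤ + (row + upper)))
    ≡⟨ cong₂ (λ x y → F 0 0 + diagonal + (0ℤ + x + (0ℤ + y)))
         (Σ-+ n (λ i → F (suc i) 0) (λ i → Σ< i (F′ i)))
         (Σ-+ n (λ j → F 0 (suc j)) (λ j → Σ< j (flip F′ j))) ⟨
  F 0 0 + diagonal + (Σ-below-diagonal (suc n) F + Σ-below-diagonal (suc n) (flip F)) ∎
  where
  open ≡-Reasoning
  open +-*-Solver
  F′ : ℕ → ℕ → ℤ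
  F′ i j = F (suc i) (suc j)
  row column diagonal lower upper : ℤ
  row      = Σ< n (λ j → F 0 (suc j))
  column   = Σ< n (λ i → F (suc i) 0)
  diagonal = Σ< n (λ i → F′ i i)
  lower    = Σ-below-diagonal n F′
  upper    = Σ-below-diagonal n (flip F′)

-- A pair j < i is reindexed by j and the gap c = i - j - 1. This gives only the pairs with j + c +
-- 1 < n; the vanishing of `F` from row `n` on fills them up to a full square.
Σ-below-diagonal-shift : ∀ n F → (∀ i j → n ≤ i → F i j ≡ 0ℤ) →
  Σ-below-diagonal n F ≡ ΣΣ< n (λ j c → F (suc (j ℕ.+ c)) j)
Σ-below-diagonal-shift zero    F F≡0 = refl
Σ-below-diagonal-shift (suc n) F F≡0 = begin
  0ℤ + Σ< n (λ i → F (suc i) 0 + Σ< i (F′ i))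
    ≡⟨ ℤ.+-identityˡ _ ⟩
  Σ< n (λ i → F (suc i) 0 + Σ< i (F′ i))
    ≡⟨ Σ-+ n (λ i → F (suc i) 0) (λ i → Σ< i (F′ i)) ⟩
  Σ< n (λ i → F (suc i) 0) + Σ-below-diagonal n F′
    ≡⟨ cong₂ _+_ (drop-last (λ c → F (suc c) 0) (F≡0 (suc n) 0 ℕ.≤-refl))
         (trans (Σ-below-diagonal-shift n F′ (λ i j n≤i → F≡0 (suc i) (suc j) (s≤s n≤i)))
                (Σ-cong n (λ j → drop-last (λ c → F′ (suc (j ℕ.+ c)) j)
                  (F≡0 (suc (suc (j ℕ.+ n))) (suc j) (s≤s (ℕ.m≤n⇒m≤1+n (ℕ.m≤n+m n j))))))) ⟩
  ΣΣ< (suc n) (λ j c → F (suc (j ℕ.+ c)) j) ∎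
  where
  open ≡-Reasoning
  F′ : ℕ → ℕ → ℤ
  F′ i j = F (suc i) (suc j)
  drop-last : ∀ f → f n ≡ 0ℤ → Σ< n f ≡ Σ< (suc n) f
  drop-last f fn≡0 = sym (trans (Σ-last n f) (trans (cong (λ x → Σ< n f + x) fn≡0) (ℤ.+-identityʳ _)))

Σ-extend : ∀ {m n} f → m ≤ n → (∀ i → m ≤ i → f i ≡ 0ℤ) → Σ< n f ≡ Σ< m f
Σ-extend {n = n} f z≤n f≡0 = Σ-0 n (λ i → f≡0 i z≤n)
Σ-extend f (s≤s m≤n) f≡0 =
  cong (λ x → f 0 + x) (Σ-extend (tail f) m≤n (λ i m≤i → f≡0 (suc i) (s≤s m≤i)))

Σ-⊛ : ∀ N (F : ℕ → Series) g → (λ m → Σ< N (λ a → F a m)) ⊛ g ≗ λ m → Σ< N (λ a → (F a ⊛ g) m)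
Σ-⊛ zero    F g = ⊛-zeroˡ g
Σ-⊛ (suc N) F g m = trans (⊛-distribʳ g (F 0) (λ m → Σ< N (λ a → F (suc a) m)) m)
                          (cong (λ x → (F 0 ⊛ g) m + x) (Σ-⊛ N (λ a → F (suc a)) g m))

-- Geometric series

q^-⊛-≥ : ∀ n f m → (q^ n ⊛ f) (n ℕ.+ m) ≡ f m
q^-⊛-≥ zero    f m = ⊛-identityˡ f m
q^-⊛-≥ (suc n) f m = trans (ℤ.+-identityˡ _) (q^-⊛-≥ n f m)

q^-≡ : ∀ {n m} → m ≡ n → (q^ n) m ≡ 1ℤ
q^-≡ {n} {m} m≡n = cong (if_then 1ℤ else 0ℤ) (dec-true (m ℕ.≟ n) m≡n)

q^-≢ : ∀ {n m} → m ≢ n → (q^ n) m ≡ 0ℤ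
q^-≢ {n} {m} m≢n = cong (if_then 1ℤ else 0ℤ) (dec-false (m ℕ.≟ n) m≢n)

q^-< : ∀ {n m} → m < n → (q^ n) m ≡ 0ℤ
q^-< m<n = q^-≢ (ℕ.<⇒≢ m<n)

q^-⊛-< : ∀ n f {m} → m < n → (q^ n ⊛ f) m ≡ 0ℤ
q^-⊛-< n f {m} m<n = trans
  (⊛-cong-≤ {g = f} m (λ i i≤m → q^-< (ℕ.≤-<-trans i≤m m<n)) (λ _ _ → refl)) (⊛-zeroˡ f m)

-- The Lambert term qᵃ / (1 - qᵃ) for a ≥ 1. The coefficient at 0 is set apart because every a
-- divides 0.
geom : ℕ → Series
geom a zero    = 0ℤ
geom a (suc m) = if does (a ∣? suc m) then 1ℤ else 0ℤ

geom-∣ : ∀ {a m} → a ℕ.∣ suc m → geom a (suc m) ≡ 1ℤ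
geom-∣ {a} {m} a∣m = cong (if_then 1ℤ else 0ℤ) (dec-true (a ∣? suc m) a∣m)

geom-∤ : ∀ {a m} → ¬ a ℕ.∣ suc m → geom a (suc m) ≡ 0ℤ
geom-∤ {a} {m} a∤m = cong (if_then 1ℤ else 0ℤ) (dec-false (a ∣? suc m) a∤m)

geom-< : ∀ {a m} → m < a → geom a m ≡ 0ℤ
geom-< {a} {zero}  m<a = refl
geom-< {a} {suc m} m<a = geom-∤ (λ a∣m → ℕ.<⇒≱ m<a (ℕ.∣⇒≤ a∣m))

geom-periodic : ∀ a m → geom (suc a) (suc a ℕ.+ suc m) ≡ geom (suc a) (suc m)
geom-periodic a m with suc a ∣? suc m
... | yes a∣m = trans (geom-∣ (ℕ.∣m∣n⇒∣m+n ℕ.∣-refl a∣m)) (sym (geom-∣ a∣m))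
... | no  a∤m = trans (geom-∤ (λ a∣m → a∤m (ℕ.∣m+n∣m⇒∣n a∣m ℕ.∣-refl))) (sym (geom-∤ a∤m))

-- This equation stands in for division by 1 - qᵃ; the identities for products and derivatives of
-- `geom` all come from it.
geom-unfold : ∀ k → geom (suc k) ≗ q^ suc k ⊕ q^ suc k ⊛ geom (suc k)
geom-unfold k m with m ℕ.<? suc k
... | yes m<a = trans (geom-< m<a) (sym (cong₂ _+_ (q^-< m<a) (q^-⊛-< (suc k) (geom (suc k)) m<a)))
... | no  m≮a = subst (λ m → geom a m ≡ (q^ a ⊕ q^ a ⊛ geom a) m)
                  (ℕ.m+[n∸m]≡n (ℕ.≮⇒≥ m≮a)) (beyond (m ∸ a))
  where
  a = suc k
  beyond : ∀ j → geom a (a ℕ.+ j) ≡ (q^ a ⊕ q^ a ⊛ geom a) (a ℕ.+ j)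
  beyond j = trans (split j) (sym (cong (λ x → (q^ a) (a ℕ.+ j) + x) (q^-⊛-≥ a (geom a) j)))
    where
    split : ∀ j → geom a (a ℕ.+ j) ≡ (q^ a) (a ℕ.+ j) + geom a j
    split zero = trans
      (geom-∣ (subst (a ℕ.∣_) (sym (ℕ.+-identityʳ a)) ℕ.∣-refl))
      (sym (cong (λ x → x + 0ℤ) (q^-≡ (ℕ.+-identityʳ a))))
    split (suc j) = trans (geom-periodic k j) (sym (trans
      (cong (λ x → x + geom a (suc j)) (q^-≢ (ℕ.m+1+n≢m a)))
      (ℤ.+-identityˡ _)))

q^-⊛-q^ : ∀ m n → q^ m ⊛ q^ n ≗ q^ (m ℕ.+ n)
q^-⊛-q^ zero    n = ⊛-identityˡ (q^ n)
q^-⊛-q^ (suc m) n zero    = refl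
q^-⊛-q^ (suc m) n (suc i) = trans (ℤ.+-identityˡ _) (q^-⊛-q^ m n i)

θ-q^ : ∀ n → θ (q^ n) ≗ + n · q^ n
θ-q^ n m with m ℕ.≟ n
... | yes refl = refl
... | no  m≢n  = trans (trans (cong (λ x → + m * x) (q^-≢ m≢n)) (ℤ.*-zeroʳ (+ m)))
                       (sym (trans (cong (λ x → + n * x) (q^-≢ m≢n)) (ℤ.*-zeroʳ (+ n))))

-- f = h + zf has the unique solution h / (1 - z), and 1 + w = 1 / (1 - z).
geometric-solution : ∀ {z w f h} → w ≗ z ⊕ z ⊛ w → f ≗ h ⊕ z ⊛ f → f ≗ (1ˢ ⊕ w) ⊛ h
geometric-solution {z} {w} {f} {h} w≗ f≗ = begin
  f                                        ≈⟨ solve 2 (λ f w → f := f :+ (w :- w) :* f) S.refl f w ⟩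
  f ⊕ (w S.- w) ⊛ f
    ≈⟨ S.+-cong (S.refl {f}) (S.*-cong (S.+-cong (S.refl {w}) (S.-‿cong w≗)) (S.refl {f})) ⟩
  f ⊕ (w S.- (z ⊕ z ⊛ w)) ⊛ f              ≈⟨ solve 3 (λ f w z → f :+ (w :- (z :+ z :* w)) :* f
                                                 := (con 1ℤ :+ w) :* (f :- z :* f)) S.refl f w z ⟩
  (const 1ℤ ⊕ w) ⊛ (f S.- z ⊛ f)
    ≈⟨ S.*-cong (S.+-cong (λ m → ℤ.*-identityˡ (1ˢ m)) (S.refl {w})) (S.+-cong f≗ (S.refl {⊝ (z ⊛ f)})) ⟩
  (1ˢ ⊕ w) ⊛ ((h ⊕ z ⊛ f) S.- z ⊛ f)
    ≈⟨ S.*-cong (S.refl {1ˢ ⊕ w}) (solve 2 (λ h k → h :+ k :- k := h) S.refl h (z ⊛ f)) ⟩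
  (1ˢ ⊕ w) ⊛ h ∎
  where
  open SetoidReasoning S.setoid
  open SeriesSolver

-- With z = q^(a+b), both sides solve f = h + zf for the same h = z(1 + u + v): on the left expand
-- (x + xu)(y + yv) with xy = z, on the right unfold w once.
geom-⊛-geom : ∀ i j → let a = suc i; b = suc j; c = suc (suc (i ℕ.+ j)) in
  geom a ⊛ geom b ≗ geom c ⊛ geom a ⊕ geom c ⊛ geom b ⊕ geom c
geom-⊛-geom i j = begin
  u ⊛ v                            ≈⟨ geometric-solution {z} {w} {u ⊛ v} {h} (geom-unfold _) uv≗ ⟩
  (1ˢ ⊕ w) ⊛ h
    ≈⟨ geometric-solution {z} {w} {w ⊛ u ⊕ w ⊛ v ⊕ w} {h} (geom-unfold _) rhs≗ ⟨
  w ⊛ u ⊕ w ⊛ v ⊕ w ∎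
  where
  open SetoidReasoning S.setoid
  open SeriesSolver
  x = q^ suc i
  y = q^ suc j
  z = q^ suc (suc (i ℕ.+ j))
  u = geom (suc i)
  v = geom (suc j)
  w = geom (suc (suc (i ℕ.+ j)))
  h = z ⊕ z ⊛ u ⊕ z ⊛ v
  xy≗z : x ⊛ y ≗ z
  xy≗z = subst (λ c → x ⊛ y ≗ q^ suc c) (ℕ.+-suc i j) (q^-⊛-q^ (suc i) (suc j))
  uv≗ : u ⊛ v ≗ h ⊕ z ⊛ (u ⊛ v)
  uv≗ = begin
    u ⊛ v                           ≈⟨ S.*-cong (geom-unfold i) (geom-unfold j) ⟩
    (x ⊕ x ⊛ u) ⊛ (y ⊕ y ⊛ v)       ≈⟨ solve 4 (λ x y u v → (x :+ x :* u) :* (y :+ y :* v)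
                                          := (x :* y) :* (con 1ℤ :+ u) :* (con 1ℤ :+ v)) S.refl x y u v ⟩
    (x ⊛ y) ⊛ (const 1ℤ ⊕ u) ⊛ (const 1ℤ ⊕ v)
      ≈⟨ S.*-cong (S.*-cong xy≗z (S.refl {const 1ℤ ⊕ u})) (S.refl {const 1ℤ ⊕ v}) ⟩
    z ⊛ (const 1ℤ ⊕ u) ⊛ (const 1ℤ ⊕ v)
      ≈⟨ solve 3 (λ z u v → z :* (con 1ℤ :+ u) :* (con 1ℤ :+ v)
            := z :+ z :* u :+ z :* v :+ z :* (u :* v)) S.refl z u v ⟩
    h ⊕ z ⊛ (u ⊛ v) ∎
  rhs≗ : w ⊛ u ⊕ w ⊛ v ⊕ w ≗ h ⊕ z ⊛ (w ⊛ u ⊕ w ⊛ v ⊕ w)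
  rhs≗ = begin
    w ⊛ u ⊕ w ⊛ v ⊕ w
      ≈⟨ S.+-cong (S.+-cong (S.*-cong w≗ (S.refl {u})) (S.*-cong w≗ (S.refl {v}))) w≗ ⟩
    (z ⊕ z ⊛ w) ⊛ u ⊕ (z ⊕ z ⊛ w) ⊛ v ⊕ (z ⊕ z ⊛ w)
      ≈⟨ solve 4 (λ z w u v → (z :+ z :* w) :* u :+ (z :+ z :* w) :* v :+ (z :+ z :* w)
            := z :+ z :* u :+ z :* v :+ z :* (w :* u :+ w :* v :+ w)) S.refl z w u v ⟩
    h ⊕ z ⊛ (w ⊛ u ⊕ w ⊛ v ⊕ w) ∎
    where
    w≗ : w ≗ z ⊕ z ⊛ w
    w≗ = geom-unfold _

-- Applying θ to u = x + xu gives θu = a(x + xu) + xθu, again an equation of the form f = h + xf,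
-- now with h = au.
θ-geom : ∀ i → θ (geom (suc i)) ≗ + suc i · (geom (suc i) ⊕ geom (suc i) ⊛ geom (suc i))
θ-geom i = begin
  θ u                       ≈⟨ geometric-solution {x} {u} {θ u} {h} (geom-unfold i) θu≗ ⟩
  (1ˢ ⊕ u) ⊛ h
    ≈⟨ S.*-cong (S.+-cong (λ m → sym (ℤ.*-identityˡ (1ˢ m))) (S.refl {u})) (S.refl {h}) ⟩
  (const 1ℤ ⊕ u) ⊛ (const a ⊛ (x ⊕ x ⊛ u))
                            ≈⟨ S.*-cong (S.refl {const 1ℤ ⊕ u}) (S.*-cong (S.refl {const a}) (S.sym (geom-unfold i))) ⟩
  (const 1ℤ ⊕ u) ⊛ (const a ⊛ u)
                            ≈⟨ solve 2 (λ u c → (con 1ℤ :+ u) :* (c :* u) := c :* (u :+ u :* u))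
                                 S.refl u (const a) ⟩
  const a ⊛ (u ⊕ u ⊛ u)     ≈⟨ const-⊛ a (u ⊕ u ⊛ u) ⟩
  a · (u ⊕ u ⊛ u)           ∎
  where
  open SetoidReasoning S.setoid
  open SeriesSolver
  a = + suc i
  x = q^ suc i
  u = geom (suc i)
  h = const a ⊛ (x ⊕ x ⊛ u)
  θx≗ : θ x ≗ const a ⊛ x
  θx≗ = S.trans {θ x} {a · x} (θ-q^ (suc i)) (S.sym (const-⊛ a x))
  θu≗ : θ u ≗ h ⊕ x ⊛ θ u
  θu≗ = begin
    θ u                          ≈⟨ θ-cong (geom-unfold i) ⟩
    θ (x ⊕ x ⊛ u)                ≈⟨ θ-⊕ x (x ⊛ u) ⟩
    θ x ⊕ θ (x ⊛ u)              ≈⟨ S.+-cong (S.refl {θ x}) (θ-⊛ x u) ⟩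
    θ x ⊕ (θ x ⊛ u ⊕ x ⊛ θ u)    ≈⟨ S.+-cong θx≗ (S.+-cong (S.*-cong θx≗ (S.refl {u})) (S.refl {x ⊛ θ u})) ⟩
    const a ⊛ x ⊕ (const a ⊛ x ⊛ u ⊕ x ⊛ θ u)
      ≈⟨ solve 4 (λ c x u d → c :* x :+ (c :* x :* u :+ d) := c :* (x :+ x :* u) :+ d)
           S.refl (const a) x u (x ⊛ θ u) ⟩
    h ⊕ x ⊛ θ u ∎

geom-square : ∀ i n → + suc i * (geom (suc i) ⊛ geom (suc i)) n ≡ (+ n - + suc i) * geom (suc i) n
geom-square i n = begin
  a * s                  ≡⟨ solve 3 (λ a u s → a :* s := a :* (u :+ s) :- a :* u) refl a u s ⟩
  a * (u + s) - a * u    ≡⟨ cong (λ x → x - a * u) (θ-geom i n) ⟨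
  + n * u - a * u        ≡⟨ solve 3 (λ a d u → d :* u :- a :* u := (d :- a) :* u) refl a (+ n) u ⟩
  (+ n - a) * u          ∎
  where
  open ≡-Reasoning
  open +-*-Solver
  a = + suc i
  u = geom (suc i) n
  s = (geom (suc i) ⊛ geom (suc i)) n

-- Divisor sums as Lambert series

σˢ : ℕ → Series
σˢ k n = + σ k n

pos-^ : ∀ m k → + (m ℕ.^ k) ≡ (+ m) ^ k
pos-^ m zero    = refl
pos-^ m (suc k) = trans (ℤ.pos-* m (m ℕ.^ k)) (cong (λ x → + m * x) (pos-^ m k))

-- The cutoff `N` may be any bound on `n`, since `geom a n` vanishes for a > n. A single cutoff thus
-- serves all coefficients that enter a product.
σ-geom : ∀ k {N n} → n ≤ N → σˢ k n ≡ Σ< N (λ i → (+ suc i) ^ k * geom (suc i) n)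
σ-geom k {N} {n} n≤N = trans (go n) (sym (Σ-extend (λ i → (+ suc i) ^ k * geom (suc i) n) n≤N
  (λ i n≤i → trans (cong (λ x → (+ suc i) ^ k * x) (geom-< (s≤s n≤i))) (ℤ.*-zeroʳ ((+ suc i) ^ k)))))
  where
  -- The enumeration `f` is general because the recursion of `applyUpTo` replaces it by `f ∘ suc`.
  list : ∀ m f N → + ℕ.sum (map (ℕ._^ k) (filter (ℕ._∣? suc m) (applyUpTo f N))) ≡
                   Σ< N (λ i → (+ f i) ^ k * geom (f i) (suc m))
  list m f zero    = refl
  list m f (suc N) with does (f 0 ∣? suc m)
  ... | true  = trans (ℤ.pos-+ (f 0 ℕ.^ k) _)
    (cong₂ _+_ (trans (pos-^ (f 0) k) (sym (ℤ.*-identityʳ ((+ f 0) ^ k)))) (list m (f ∘ suc) N))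
  ... | false = trans (list m (f ∘ suc) N)
    (sym (trans (cong (λ x → x + Σ< N (λ i → (+ f (suc i)) ^ k * geom (f (suc i)) (suc m)))
                      (ℤ.*-zeroʳ ((+ f 0) ^ k)))
                (ℤ.+-identityˡ _)))
  go : ∀ n → σˢ k n ≡ Σ< n (λ i → (+ suc i) ^ k * geom (suc i) n)
  go zero    = refl
  go (suc m) = list m suc (suc m)

Σ-σ : ∀ k n → Σ< n (λ i → (+ suc i) ^ k * geom (suc i) n) ≡ σˢ k n
Σ-σ k n = sym (σ-geom k {n} ℕ.≤-refl)

geomCoeff² : ℕ → ℕ → ℕ → ℤ
geomCoeff² n i j = (geom (suc i) ⊛ geom (suc j)) n

ΣΣ-σ : ∀ k l n → ΣΣ< n (λ i j → ((+ suc i) ^ k * (+ suc j) ^ l) * geomCoeff² n i j) ≡ (σˢ k ⊛ σˢ l) n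
ΣΣ-σ k l n = sym (begin
  (σˢ k ⊛ σˢ l) n
    ≡⟨ ⊛-cong-≤ {g = σˢ l} n (λ m m≤n → σ-geom k m≤n) (λ _ _ → refl) ⟩
  (partialσ k ⊛ σˢ l) n
    ≡⟨ Σ-⊛ n (λ i → a i ^ k · geom (suc i)) (σˢ l) n ⟩
  Σ< n (λ i → (a i ^ k · geom (suc i) ⊛ σˢ l) n)
    ≡⟨ Σ-cong n inner ⟩
  ΣΣ< n (λ i j → (a i ^ k * a j ^ l) * geomCoeff² n i j) ∎)
  where
  open ≡-Reasoning
  a : ℕ → ℤ
  a i = + suc i
  partialσ : ℕ → Series
  partialσ k m = Σ< n (λ i → (a i ^ k · geom (suc i)) m)
  inner : ∀ i → (a i ^ k · geom (suc i) ⊛ σˢ l) n ≡ Σ< n (λ j → (a i ^ k * a j ^ l) * geomCoeff² n i j)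
  inner i = begin
    (f ⊛ σˢ l) n
      ≡⟨ ⊛-cong-≤ {f = f} n (λ _ _ → refl) (λ m m≤n → σ-geom l m≤n) ⟩
    (f ⊛ partialσ l) n
      ≡⟨ ⊛-comm f (partialσ l) n ⟩
    (partialσ l ⊛ f) n
      ≡⟨ Σ-⊛ n (λ j → a j ^ l · geom (suc j)) f n ⟩
    Σ< n (λ j → (a j ^ l · geom (suc j) ⊛ f) n)
      ≡⟨ Σ-cong n (λ j → trans (·-⊛ (a j ^ l) (geom (suc j)) f n)
           (trans (cong (λ x → a j ^ l * x) (trans (⊛-comm (geom (suc j)) f n)
                    (·-⊛ (a i ^ k) (geom (suc i)) (geom (suc j)) n)))
                  (solve 3 (λ x y z → y :* (x :* z) := x :* y :* z) refl (a i ^ k) (a j ^ l) (geomCoeff² n i j)))) ⟩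
    Σ< n (λ j → (a i ^ k * a j ^ l) * geomCoeff² n i j) ∎
    where
    open +-*-Solver
    f : Series
    f = a i ^ k · geom (suc i)

-- Sums over pairs weighted by an invariant of the hexagonal lattice

module HexagonalInvariant
  (h : ℤ → ℤ → ℤ)
  (h-sym : ∀ a b → h a b ≡ h b a)
  (h-reflect : ∀ a b → h (a + b) a ≡ h (a + b) b)
  (n : ℕ)
  where

  private
    open ≡-Reasoning
    a : ℕ → ℤ
    a i = + suc i

    c : ℕ → ℕ → ℕ
    c i j = suc (i ℕ.+ j)

    G H : ℕ → ℕ → ℤ
    G = geomCoeff² n
    H i j = h (a i) (a j)

    L : ℕ → ℤ
    L i = geom (suc i) n

    L-vanishes : ∀ i → n ≤ i → L i ≡ 0ℤ
    L-vanishes i n≤i = geom-< (s≤s n≤i)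

    G-vanishes : ∀ i j → n ≤ i → G i j ≡ 0ℤ
    G-vanishes i j n≤i = trans
      (⊛-cong-≤ {f′ = 0ˢ} {g = geom (suc j)} n (λ m m≤n → geom-< (s≤s (ℕ.≤-trans m≤n n≤i))) (λ _ _ → refl))
      (⊛-zeroˡ (geom (suc j)) n)

    a-+ : ∀ i j → a (c i j) ≡ a i + a j
    a-+ i j = cong (λ x → + suc x) (sym (ℕ.+-suc i j))

    H-reflect : ∀ i j → H (c i j) i ≡ H (c i j) j
    H-reflect i j rewrite a-+ i j = h-reflect (a i) (a j)

    HG : ℕ → ℕ → ℤ
    HG i j = H i j * G i j

    -- Both triangles of Σ h(a, b) g_a g_b, and both quadratic terms produced by the product formula
    -- in the shifted sum, equal `X`; so `X + X` cancels in the final difference.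
    X : ℤ
    X = ΣΣ< n (λ i j → HG (c i j) i)

    below : Σ-below-diagonal n HG ≡ X
    below = Σ-below-diagonal-shift n HG
      (λ i j n≤i → trans (cong (λ x → H i j * x) (G-vanishes i j n≤i)) (ℤ.*-zeroʳ (H i j)))

    above : Σ-below-diagonal n (flip HG) ≡ X
    above = trans (Σ-cong n (λ i → Σ-cong i (λ j →
      cong₂ _*_ (h-sym (a j) (a i)) (⊛-comm (geom (suc j)) (geom (suc i)) n)))) below

    -- Exchanging the summation indices turns g_{a+b} g_b into g_{a+b} g_a and h(a+b, a) into h(a+b,
    -- b); the reflection symmetry of `h` undoes the latter.
    reflected : ΣΣ< n (λ i j → H (c i j) i * G (c i j) j) ≡ X
    reflected = trans (Σ-comm n n (λ i j → H (c i j) i * G (c i j) j)) (ΣΣ-cong n (λ i j →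
      trans (cong (λ x → H x j * G x i) (cong suc (ℕ.+-comm j i)))
            (cong (λ x → x * G (c i j) i) (sym (H-reflect i j)))))

    lower : ℤ
    lower = Σ-below-diagonal n (λ i j → H i j * L i)

    lower-shift : lower ≡ ΣΣ< n (λ i j → H (c i j) i * L (c i j))
    lower-shift = Σ-below-diagonal-shift n (λ i j → H i j * L i)
      (λ i j n≤i → trans (cong (λ x → H i j * x) (L-vanishes i n≤i)) (ℤ.*-zeroʳ (H i j)))

    shifted : ΣΣ< n (λ i j → h (a i + a j) (a i) * G i j) ≡ X + X + lower
    shifted = begin
      ΣΣ< n (λ i j → h (a i + a j) (a i) * G i j)
        ≡⟨ ΣΣ-cong n (λ i j → cong₂ _*_ (cong (λ x → h x (a i)) (sym (a-+ i j))) (geom-⊛-geom i j n)) ⟩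
      ΣΣ< n (λ i j → H (c i j) i * (G (c i j) i + G (c i j) j + L (c i j)))
        ≡⟨ ΣΣ-cong n (λ i j → trans (ℤ.*-distribˡ-+ (H (c i j) i) (G (c i j) i + G (c i j) j) (L (c i j)))
             (cong (λ x → x + H (c i j) i * L (c i j)) (ℤ.*-distribˡ-+ (H (c i j) i) (G (c i j) i) (G (c i j) j)))) ⟩
      ΣΣ< n (λ i j → HG (c i j) i + H (c i j) i * G (c i j) j + H (c i j) i * L (c i j))
        ≡⟨ ΣΣ-+ n (λ i j → HG (c i j) i + H (c i j) i * G (c i j) j) (λ i j → H (c i j) i * L (c i j)) ⟩
      ΣΣ< n (λ i j → HG (c i j) i + H (c i j) i * G (c i j) j) + ΣΣ< n (λ i j → H (c i j) i * L (c i j))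
        ≡⟨ cong₂ _+_ (trans (ΣΣ-+ n (λ i j → HG (c i j) i) (λ i j → H (c i j) i * G (c i j) j))
                            (cong (λ x → X + x) reflected))
                     (sym lower-shift) ⟩
      X + X + lower ∎

  identity :
    ΣΣ< n (λ i j → (h (+ suc i + + suc j) (+ suc i) - h (+ suc i) (+ suc j)) * geomCoeff² n i j) ≡
    Σ< n (λ i → Σ< i (λ j → h (+ suc i) (+ suc j)) * geom (suc i) n) -
    Σ< n (λ i → h (+ suc i) (+ suc i) * geomCoeff² n i i)
  identity = begin
    ΣΣ< n (λ i j → (h (a i + a j) (a i) - H i j) * G i j)
      ≡⟨ ΣΣ-cong n (λ i j → solve 3 (λ x y z → (x :- y) :* z := x :* z :- y :* z) refl (h (a i + a j) (a i)) (H i j) (G i j)) ⟩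
    ΣΣ< n (λ i j → h (a i + a j) (a i) * G i j - HG i j)
      ≡⟨ ΣΣ-∸ n (λ i j → h (a i + a j) (a i) * G i j) HG ⟨
    ΣΣ< n (λ i j → h (a i + a j) (a i) * G i j) - ΣΣ< n HG
      ≡⟨ cong₂ _-_ shifted (trans (Σ-square n HG) (cong₂ (λ x y → diagonal + (x + y)) below above)) ⟩
    X + X + lower - (diagonal + (X + X))
      ≡⟨ solve 3 (λ x l d → x :+ x :+ l :- (d :+ (x :+ x)) := l :- d) refl X lower diagonal ⟩
    lower - diagonal
      ≡⟨ cong (λ x → x - diagonal) (Σ-cong n (λ i → trans
           (Σ-cong i (λ j → ℤ.*-comm (H i j) (L i)))
           (trans (sym (Σ-· i (L i) (H i))) (ℤ.*-comm (L i) (Σ< i (H i)))))) ⟩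
    Σ< n (λ i → Σ< i (H i) * L i) - diagonal ∎
    where
    open +-*-Solver
    diagonal : ℤ
    diagonal = Σ< n (λ i → HG i i)

-- From polynomial invariants to relations between divisor sums

eval₁ : List (ℤ × ℕ) → ℤ → ℤ
eval₁ []             x = 0ℤ
eval₁ ((c , k) ∷ ps) x = c * x ^ k + eval₁ ps x

eval₂ : List (ℤ × ℕ × ℕ) → ℤ → ℤ → ℤ
eval₂ []                 x y = 0ℤ
eval₂ ((c , k , l) ∷ ps) x y = c * (x ^ k * y ^ l) + eval₂ ps x y

-- Ending in `const 0ℤ` makes a combination, by computation, the denotation of a solver polynomial
-- ending in `con 0ℤ`, so the relations can later be passed to `by-relations` unchanged.
combination : List (ℤ × Series) → Series
combination []             = const 0ℤ
combination ((c , f) ∷ fs) = const c ⊛ f ⊕ combination fs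

σ-combination : List (ℤ × ℕ) → Series
σ-combination = combination ∘ map (λ (c , k) → c , σˢ k)

θσ-combination : List (ℤ × ℕ) → Series
θσ-combination = combination ∘ map (λ (c , k) → c , θ (σˢ k))

σσ-combination : List (ℤ × ℕ × ℕ) → Series
σσ-combination = combination ∘ map (λ (c , k , l) → c , σˢ k ⊛ σˢ l)

const-0 : const 0ℤ ≗ 0ˢ
const-0 m = ℤ.*-zeroˡ (1ˢ m)

Σ-eval₁ : ∀ ps n → Σ< n (λ i → eval₁ ps (+ suc i) * geom (suc i) n) ≡ σ-combination ps n
Σ-eval₁ []             n = trans (Σ-0 n (λ i → ℤ.*-zeroˡ (geom (suc i) n))) (sym (const-0 n))
Σ-eval₁ ((c , k) ∷ ps) n = begin
  Σ< n (λ i → (c * a i ^ k + eval₁ ps (a i)) * L i)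
    ≡⟨ Σ-cong n (λ i → trans (ℤ.*-distribʳ-+ (L i) (c * a i ^ k) (eval₁ ps (a i)))
         (cong (λ x → x + eval₁ ps (a i) * L i) (ℤ.*-assoc c (a i ^ k) (L i)))) ⟩
  Σ< n (λ i → c * (a i ^ k * L i) + eval₁ ps (a i) * L i)
    ≡⟨ Σ-+ n (λ i → c * (a i ^ k * L i)) (λ i → eval₁ ps (a i) * L i) ⟩
  Σ< n (λ i → c * (a i ^ k * L i)) + Σ< n (λ i → eval₁ ps (a i) * L i)
    ≡⟨ cong₂ _+_ (trans (sym (Σ-· n c (λ i → a i ^ k * L i)))
                 (trans (cong (λ x → c * x) (Σ-σ k n)) (sym (const-⊛ c (σˢ k) n))))
                 (Σ-eval₁ ps n) ⟩
  (const c ⊛ σˢ k) n + σ-combination ps n ∎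
  where
  open ≡-Reasoning
  a L : ℕ → ℤ
  a i = + suc i
  L i = geom (suc i) n

ΣΣ-eval₂ : ∀ ps n → ΣΣ< n (λ i j → eval₂ ps (+ suc i) (+ suc j) * geomCoeff² n i j) ≡ σσ-combination ps n
ΣΣ-eval₂ []                 n =
  trans (Σ-0 n (λ i → Σ-0 n (λ j → ℤ.*-zeroˡ (geomCoeff² n i j)))) (sym (const-0 n))
ΣΣ-eval₂ ((c , k , l) ∷ ps) n = begin
  ΣΣ< n (λ i j → (c * w i j + eval₂ ps (a i) (a j)) * G i j)
    ≡⟨ ΣΣ-cong n (λ i j → trans (ℤ.*-distribʳ-+ (G i j) (c * w i j) (eval₂ ps (a i) (a j)))
         (cong (λ x → x + eval₂ ps (a i) (a j) * G i j) (ℤ.*-assoc c (w i j) (G i j)))) ⟩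
  ΣΣ< n (λ i j → c * (w i j * G i j) + eval₂ ps (a i) (a j) * G i j)
    ≡⟨ ΣΣ-+ n (λ i j → c * (w i j * G i j)) (λ i j → eval₂ ps (a i) (a j) * G i j) ⟩
  ΣΣ< n (λ i j → c * (w i j * G i j)) + ΣΣ< n (λ i j → eval₂ ps (a i) (a j) * G i j)
    ≡⟨ cong₂ _+_ (trans (sym (ΣΣ-· n c (λ i j → w i j * G i j)))
                 (trans (cong (λ x → c * x) (ΣΣ-σ k l n)) (sym (const-⊛ c (σˢ k ⊛ σˢ l) n))))
                 (ΣΣ-eval₂ ps n) ⟩
  (const c ⊛ (σˢ k ⊛ σˢ l)) n + σσ-combination ps n ∎
  where
  open ≡-Reasoning
  a : ℕ → ℤ
  a i = + suc i
  w G : ℕ → ℕ → ℤ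
  w i j = a i ^ k * a j ^ l
  G = geomCoeff² n

θσ-combination-coeff : ∀ ds n → θσ-combination ds n ≡ + n * σ-combination ds n
θσ-combination-coeff []             n = trans (const-0 n)
  (sym (trans (cong (λ x → + n * x) (const-0 n)) (ℤ.*-zeroʳ (+ n))))
θσ-combination-coeff ((d , k) ∷ ds) n = begin
  (const d ⊛ θ (σˢ k)) n + θσ-combination ds n
    ≡⟨ cong₂ _+_ (const-⊛ d (θ (σˢ k)) n) (θσ-combination-coeff ds n) ⟩
  d * (+ n * σˢ k n) + + n * σ-combination ds n
    ≡⟨ solve 4 (λ d n s r → d :* (n :* s) :+ n :* r := n :* (d :* s :+ r)) refl d (+ n) (σˢ k n) (σ-combination ds n) ⟩
  + n * (d * σˢ k n + σ-combination ds n)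
    ≡⟨ cong (λ x → + n * (x + σ-combination ds n)) (const-⊛ d (σˢ k) n) ⟨
  + n * ((const d ⊛ σˢ k) n + σ-combination ds n) ∎
  where
  open ≡-Reasoning
  open +-*-Solver

-- Telescoping: the value at 0 and the difference equation characterise the Faulhaber polynomial
-- `P`, and both are plain polynomial identities. The factor `c` keeps its coefficients integral.
partial-sum : ∀ c (h P : ℤ → ℤ) → P 0ℤ ≡ 0ℤ → (∀ x → P (1ℤ + x) ≡ P x + c * h (1ℤ + x)) →
              ∀ m → c * Σ< m (λ j → h (+ suc j)) ≡ P (+ m)
partial-sum c h P P0 P+ zero    = trans (ℤ.*-zeroʳ c) (sym P0)
partial-sum c h P P0 P+ (suc m) = begin
  c * Σ< (suc m) h′            ≡⟨ cong (λ x → c * x) (Σ-last m h′) ⟩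
  c * (Σ< m h′ + h (+ suc m))  ≡⟨ ℤ.*-distribˡ-+ c (Σ< m h′) (h (+ suc m)) ⟩
  c * Σ< m h′ + c * h (+ suc m)  ≡⟨ cong (λ x → x + c * h (+ suc m)) (partial-sum c h P P0 P+ m) ⟩
  P (+ m) + c * h (+ suc m)    ≡⟨ P+ (+ m) ⟨
  P (+ suc m)                  ∎
  where
  open ≡-Reasoning
  h′ : ℕ → ℤ
  h′ j = h (+ suc j)

-- After scaling by `c`, the odd polynomial h(a+b, a) - h(a, b) yields the products in `qs`, the
-- diagonal h(a, a) divided by a yields the θ-terms in `ds`, and the Faulhaber sum at x = a yields
-- the linear terms in `ps`.
convolution-identity :
  (h : ℤ → ℤ → ℤ) →
  (∀ a b → h a b ≡ h b a) →
  (∀ a b → h (a + b) a ≡ h (a + b) b) →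
  ∀ c qs ds ps (P : ℤ → ℤ → ℤ) →
  (∀ a b → c * (h (a + b) a - h a b) ≡ eval₂ qs a b) →
  (∀ a → c * h a a ≡ eval₁ ds a * a) →
  (∀ a → P a 0ℤ ≡ 0ℤ) →
  (∀ a x → P a (1ℤ + x) ≡ P a x + c * h a (1ℤ + x)) →
  (∀ a → P a a ≡ eval₁ ps a) →
  σσ-combination qs ⊕ θσ-combination ds ≗ σ-combination ps
convolution-identity h h-sym h-reflect c qs ds ps P h-odd h-diag P0 P+ P-diag n = begin
  σσ-combination qs n + θσ-combination ds n
    ≡⟨ cong₂ _+_ (sym (ΣΣ-eval₂ qs n)) (θσ-combination-coeff ds n) ⟩
  ΣΣ< n (λ i j → eval₂ qs (a i) (a j) * G i j) + + n * σ-combination ds n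
    ≡⟨ cong (λ x → x + + n * σ-combination ds n) (begin
         ΣΣ< n (λ i j → eval₂ qs (a i) (a j) * G i j)
           ≡⟨ ΣΣ-cong n (λ i j → trans (cong (λ x → x * G i j) (sym (h-odd (a i) (a j))))
                (ℤ.*-assoc c (h (a i + a j) (a i) - h (a i) (a j)) (G i j))) ⟩
         ΣΣ< n (λ i j → c * ((h (a i + a j) (a i) - h (a i) (a j)) * G i j))
           ≡⟨ ΣΣ-· n c (λ i j → (h (a i + a j) (a i) - h (a i) (a j)) * G i j) ⟨
         c * ΣΣ< n (λ i j → (h (a i + a j) (a i) - h (a i) (a j)) * G i j)
           ≡⟨ cong (λ x → c * x) (HexagonalInvariant.identity h h-sym h-reflect n) ⟩
         c * (Σ< n (λ i → Σ< i (λ j → h (a i) (a j)) * L i) - Σ< n (λ i → h (a i) (a i) * G i i))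
           ≡⟨ cong (λ x → c * x) (Σ-∸ n (λ i → Σ< i (λ j → h (a i) (a j)) * L i) (λ i → h (a i) (a i) * G i i)) ⟩
         c * Σ< n (λ i → Σ< i (λ j → h (a i) (a j)) * L i - h (a i) (a i) * G i i)
           ≡⟨ Σ-· n c (λ i → Σ< i (λ j → h (a i) (a j)) * L i - h (a i) (a i) * G i i) ⟩
         Σ< n (λ i → c * (Σ< i (λ j → h (a i) (a j)) * L i - h (a i) (a i) * G i i))
           ≡⟨ Σ-cong n term ⟩
         Σ< n (λ i → eval₁ ps (a i) * L i - + n * (eval₁ ds (a i) * L i))
           ≡⟨ Σ-∸ n (λ i → eval₁ ps (a i) * L i) (λ i → + n * (eval₁ ds (a i) * L i)) ⟨
         Σ< n (λ i → eval₁ ps (a i) * L i) - Σ< n (λ i → + n * (eval₁ ds (a i) * L i))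
           ≡⟨ cong₂ _-_ (Σ-eval₁ ps n) (trans (sym (Σ-· n (+ n) (λ i → eval₁ ds (a i) * L i)))
                                              (cong (λ x → + n * x) (Σ-eval₁ ds n))) ⟩
         σ-combination ps n - + n * σ-combination ds n ∎) ⟩
  σ-combination ps n - + n * σ-combination ds n + + n * σ-combination ds n
    ≡⟨ solve 2 (λ x y → x :- y :+ y := x) refl (σ-combination ps n) (+ n * σ-combination ds n) ⟩
  σ-combination ps n ∎
  where
  open ≡-Reasoning
  open +-*-Solver
  a L : ℕ → ℤ
  a i = + suc i
  L i = geom (suc i) n
  G : ℕ → ℕ → ℤ
  G = geomCoeff² n
  -- The Faulhaber sum includes b = a, so c h(a, a) g_a has to be subtracted. Together with c h(a,
  -- a) g_a² this is d(a)(a g_a + a g_a²) = d(a) θg_a, because c h(a, a) = d(a) a.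
  term : ∀ i → c * (Σ< i (λ j → h (a i) (a j)) * L i - h (a i) (a i) * G i i) ≡
               eval₁ ps (a i) * L i - + n * (eval₁ ds (a i) * L i)
  term i = begin
    c * (s * L i - hᵢᵢ * G i i)
      ≡⟨ solve 5 (λ c s l h g → c :* (s :* l :- h :* g) := (c :* (s :+ h) :- c :* h) :* l :- c :* h :* g)
           refl c s (L i) hᵢᵢ (G i i) ⟩
    (c * (s + hᵢᵢ) - c * hᵢᵢ) * L i - c * hᵢᵢ * G i i
      ≡⟨ cong₂ (λ x y → (x - y) * L i - y * G i i) full (h-diag (a i)) ⟩
    (e - d * a i) * L i - d * a i * G i i
      ≡⟨ solve 5 (λ e d a l g → (e :- d :* a) :* l :- d :* a :* g := e :* l :- d :* a :* l :- d :* (a :* g))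
           refl e d (a i) (L i) (G i i) ⟩
    e * L i - d * a i * L i - d * (a i * G i i)
      ≡⟨ cong (λ x → e * L i - d * a i * L i - d * x) (geom-square i n) ⟩
    e * L i - d * a i * L i - d * ((+ n - a i) * L i)
      ≡⟨ solve 5 (λ e d a l n → e :* l :- d :* a :* l :- d :* ((n :- a) :* l) := e :* l :- n :* (d :* l))
           refl e d (a i) (L i) (+ n) ⟩
    e * L i - + n * (d * L i) ∎
    where
    s hᵢᵢ d e : ℤ
    s   = Σ< i (λ j → h (a i) (a j))
    hᵢᵢ = h (a i) (a i)
    d   = eval₁ ds (a i)
    e   = eval₁ ps (a i)
    full : c * (s + hᵢᵢ) ≡ e
    full = begin
      c * (s + hᵢᵢ)                          ≡⟨ cong (λ x → c * x) (Σ-last i (λ j → h (a i) (a j))) ⟨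
      c * Σ< (suc i) (λ j → h (a i) (a j))   ≡⟨ partial-sum c (h (a i)) (P (a i)) (P0 (a i)) (P+ (a i)) (suc i) ⟩
      P (a i) (a i)                          ≡⟨ P-diag (a i) ⟩
      e ∎

-- Explicit convolution identities

module Convolutions where

  open +-*-Solver

  êval₁ : ∀ {m} → List (ℤ × ℕ) → Polynomial m → Polynomial m
  êval₁ []             x = con 0ℤ
  êval₁ ((c , k) ∷ ps) x = con c :* x :^ k :+ êval₁ ps x

  êval₂ : ∀ {m} → List (ℤ × ℕ × ℕ) → Polynomial m → Polynomial m → Polynomial m
  êval₂ []                 x y = con 0ℤ
  êval₂ ((c , k , l) ∷ ps) x y = con c :* (x :^ k :* y :^ l) :+ êval₂ ps x y

  module _ {m} (ρ : Env m) where

    ⟦:^⟧ : ∀ x k → ⟦ x :^ k ⟧ ρ ≡ ⟦ x ⟧ ρ ^ k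
    ⟦:^⟧ x zero    = refl
    ⟦:^⟧ x (suc k) = cong (λ y → ⟦ x ⟧ ρ * y) (⟦:^⟧ x k)

    ⟦êval₁⟧ : ∀ ps x → ⟦ êval₁ ps x ⟧ ρ ≡ eval₁ ps (⟦ x ⟧ ρ)
    ⟦êval₁⟧ []             x = refl
    ⟦êval₁⟧ ((c , k) ∷ ps) x = cong₂ (λ y z → c * y + z) (⟦:^⟧ x k) (⟦êval₁⟧ ps x)

    ⟦êval₂⟧ : ∀ ps x y → ⟦ êval₂ ps x y ⟧ ρ ≡ eval₂ ps (⟦ x ⟧ ρ) (⟦ y ⟧ ρ)
    ⟦êval₂⟧ []                 x y = refl
    ⟦êval₂⟧ ((c , k , l) ∷ ps) x y =
      cong₂ (λ u v → c * u + v) (cong₂ _*_ (⟦:^⟧ x k) (⟦:^⟧ y l)) (⟦êval₂⟧ ps x y)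

  -- Normal forms are compared as syntax: comparing their values, as solve does,
  -- is far too slow at the degrees below.
  infix 4 _≋_

  _≋_ : ∀ {m} → Polynomial m → Polynomial m → Set
  p ≋ q = normalise p ≡ normalise q

  ≋-sound : ∀ {m} (p q : Polynomial m) → p ≋ q → ∀ ρ → ⟦ p ⟧ ρ ≡ ⟦ q ⟧ ρ
  ≋-sound p q p≋q ρ = prove ρ p q (cong (λ nf → ⟦ nf ⟧N ρ) p≋q)

  function : (∀ {m} → Polynomial m → Polynomial m → Polynomial m) → ℤ → ℤ → ℤ
  function ĥ a b = ⟦ ĥ (var 0F) (var 1F) ⟧ (a ∷ b ∷ [])

  module _
    (ĥ : ∀ {m} → Polynomial m → Polynomial m → Polynomial m)
    -- An arbitrary function on syntax need not commute with evaluation; each concrete `ĥ` below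
    -- does so by computation.
    (⟦ĥ⟧ : ∀ {m} (p q : Polynomial m) ρ → ⟦ ĥ p q ⟧ ρ ≡ function ĥ (⟦ p ⟧ ρ) (⟦ q ⟧ ρ))
    where

    -- Every hypothesis compares normal forms of explicit polynomials, so that an instance consists
    -- of coefficient lists and `refl`.
    polynomial-convolution-identity :
      let x : Polynomial 2
          x = var 0F
          y : Polynomial 2
          y = var 1F
          z : Polynomial 1
          z = var 0F
      in
      ĥ x y ≋ ĥ y x →
      ĥ (x :+ y) x ≋ ĥ (x :+ y) y →
      ∀ c qs ds ps Ps →
      con c :* (ĥ (x :+ y) x :- ĥ x y) ≋ êval₂ qs x y →
      con c :* ĥ z z ≋ êval₁ ds z :* z →
      êval₂ Ps z (con 0ℤ) ≋ con 0ℤ →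
      êval₂ Ps x (con 1ℤ :+ y) ≋ êval₂ Ps x y :+ con c :* ĥ x (con 1ℤ :+ y) →
      êval₂ Ps z z ≋ êval₁ ps z →
      σσ-combination qs ⊕ θσ-combination ds ≗ σ-combination ps
    polynomial-convolution-identity ≋sym ≋reflect c qs ds ps Ps ≋odd ≋diag ≋0 ≋+ ≋Pdiag =
      convolution-identity (function ĥ)
        (λ a b → trans (sym (⟦ĥ⟧ x y (a ∷ b ∷ [])))
          (trans (≋-sound (ĥ x y) (ĥ y x) ≋sym (a ∷ b ∷ [])) (⟦ĥ⟧ y x (a ∷ b ∷ []))))
        (λ a b → trans (sym (⟦ĥ⟧ (x :+ y) x (a ∷ b ∷ [])))
          (trans (≋-sound (ĥ (x :+ y) x) (ĥ (x :+ y) y) ≋reflect (a ∷ b ∷ [])) (⟦ĥ⟧ (x :+ y) y (a ∷ b ∷ []))))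
        c qs ds ps (eval₂ Ps)
        (λ a b → trans
          (cong₂ (λ u v → c * (u - v)) (sym (⟦ĥ⟧ (x :+ y) x (a ∷ b ∷ []))) (sym (⟦ĥ⟧ x y (a ∷ b ∷ []))))
          (trans (≋-sound (con c :* (ĥ (x :+ y) x :- ĥ x y)) (êval₂ qs x y) ≋odd (a ∷ b ∷ []))
                 (⟦êval₂⟧ (a ∷ b ∷ []) qs x y)))
        (λ a → trans (cong (λ u → c * u) (sym (⟦ĥ⟧ z z (a ∷ []))))
          (trans (≋-sound (con c :* ĥ z z) (êval₁ ds z :* z) ≋diag (a ∷ []))
                 (cong (λ u → u * a) (⟦êval₁⟧ (a ∷ []) ds z))))
        (λ a → trans (sym (⟦êval₂⟧ (a ∷ []) Ps z (con 0ℤ)))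
          (≋-sound (êval₂ Ps z (con 0ℤ)) (con 0ℤ) ≋0 (a ∷ [])))
        (λ a b → trans (sym (⟦êval₂⟧ (a ∷ b ∷ []) Ps x (con 1ℤ :+ y)))
          (trans (≋-sound (êval₂ Ps x (con 1ℤ :+ y)) (êval₂ Ps x y :+ con c :* ĥ x (con 1ℤ :+ y)) ≋+ (a ∷ b ∷ []))
                 (cong₂ (λ u v → u + c * v) (⟦êval₂⟧ (a ∷ b ∷ []) Ps x y) (⟦ĥ⟧ x (con 1ℤ :+ y) (a ∷ b ∷ [])))))
        (λ a → trans (sym (⟦êval₂⟧ (a ∷ []) Ps z z))
          (trans (≋-sound (êval₂ Ps z z) (êval₁ ps z) ≋Pdiag (a ∷ [])) (⟦êval₁⟧ (a ∷ []) ps z)))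
      where
      x y : Polynomial 2
      x = var 0F
      y = var 1F
      z : Polynomial 1
      z = var 0F

  -- The two symmetries required of `h` generate the dihedral group of order 12, whose basic
  -- invariants have degrees 2 and 6. Here they are the norm of the Eisenstein integer a + bω and
  -- the discriminant of t(t - a)(t - b).
  norm disc : ∀ {m} → Polynomial m → Polynomial m → Polynomial m
  norm a b = a :* a :- a :* b :+ b :* b
  disc a b = (a :* b :* (a :- b)) :* (a :* b :* (a :- b))

  -- In each instance, the last list is the Faulhaber polynomial
  -- P(a, x) = c Σ_{b≤x} h(a, b), with c clearing its denominators.

  -- Equivalent to 12 θE₂ = E₂² - E₄.
  σ₁σ₁ :
    σσ-combination ((+ 12 , 1 , 1) ∷ []) ⊕
    θσ-combination ((+ 6 , 1) ∷ []) ≗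
    σ-combination ((+ 1 , 1) ∷ (+ 5 , 3) ∷ [])
  σ₁σ₁ = polynomial-convolution-identity
    norm (λ _ _ _ → refl)
    refl refl (+ 6)
    ((+ 12 , 1 , 1) ∷ [])
    ((+ 6 , 1) ∷ [])
    ((+ 1 , 1) ∷ (+ 5 , 3) ∷ [])
    ((+ 6 , 2 , 1) ∷ (- + 3 , 1 , 2) ∷ (- + 3 , 1 , 1) ∷ (+ 2 , 0 , 3) ∷ (+ 3 , 0 , 2) ∷
     (+ 1 , 0 , 1) ∷ [])
    refl refl refl refl refl

  -- Equivalent to 3 θE₄ = E₂E₄ - E₆.
  σ₁σ₃ :
    σσ-combination ((+ 120 , 3 , 1) ∷ (+ 120 , 1 , 3) ∷ []) ⊕
    θσ-combination ((+ 30 , 3) ∷ []) ≗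
    σ-combination ((- + 1 , 1) ∷ (+ 10 , 3) ∷ (+ 21 , 5) ∷ [])
  σ₁σ₃ = polynomial-convolution-identity
    (λ a b → norm a b :* norm a b) (λ _ _ _ → refl)
    refl refl (+ 30)
    ((+ 120 , 3 , 1) ∷ (+ 120 , 1 , 3) ∷ [])
    ((+ 30 , 3) ∷ [])
    ((- + 1 , 1) ∷ (+ 10 , 3) ∷ (+ 21 , 5) ∷ [])
    ((+ 30 , 4 , 1) ∷ (- + 30 , 3 , 2) ∷ (- + 30 , 3 , 1) ∷ (+ 30 , 2 , 3) ∷ (+ 45 , 2 , 2) ∷
     (+ 15 , 2 , 1) ∷ (- + 15 , 1 , 4) ∷ (- + 30 , 1 , 3) ∷ (- + 15 , 1 , 2) ∷ (+ 6 , 0 , 5) ∷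
     (+ 15 , 0 , 4) ∷ (+ 10 , 0 , 3) ∷ (- + 1 , 0 , 1) ∷ [])
    refl refl refl refl refl

  -- The cube of `norm` mixes S₁S₅ with S₃² and S₇. Eliminating S₇ through `σ₃σ₃` leaves 2 θE₆ =
  -- E₂E₆ - E₄².
  σ₁σ₅-σ₃σ₃ :
    σσ-combination ((+ 2520 , 5 , 1) ∷ (+ 5880 , 3 , 3) ∷ (+ 2520 , 1 , 5) ∷ []) ⊕
    θσ-combination ((+ 420 , 5) ∷ []) ≗
    σ-combination ((+ 10 , 1) ∷ (- + 49 , 3) ∷ (+ 210 , 5) ∷ (+ 249 , 7) ∷ [])
  σ₁σ₅-σ₃σ₃ = polynomial-convolution-identity
    (λ a b → norm a b :* norm a b :* norm a b) (λ _ _ _ → refl)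
    refl refl (+ 420)
    ((+ 2520 , 5 , 1) ∷ (+ 5880 , 3 , 3) ∷ (+ 2520 , 1 , 5) ∷ [])
    ((+ 420 , 5) ∷ [])
    ((+ 10 , 1) ∷ (- + 49 , 3) ∷ (+ 210 , 5) ∷ (+ 249 , 7) ∷ [])
    ((+ 420 , 6 , 1) ∷ (- + 630 , 5 , 2) ∷ (- + 630 , 5 , 1) ∷ (+ 840 , 4 , 3) ∷ (+ 1260 , 4 , 2) ∷
     (+ 420 , 4 , 1) ∷ (- + 735 , 3 , 4) ∷ (- + 1470 , 3 , 3) ∷ (- + 735 , 3 , 2) ∷
     (+ 504 , 2 , 5) ∷ (+ 1260 , 2 , 4) ∷ (+ 840 , 2 , 3) ∷ (- + 84 , 2 , 1) ∷ (- + 210 , 1 , 6) ∷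
     (- + 630 , 1 , 5) ∷ (- + 525 , 1 , 4) ∷ (+ 105 , 1 , 2) ∷ (+ 60 , 0 , 7) ∷ (+ 210 , 0 , 6) ∷
     (+ 210 , 0 , 5) ∷ (- + 70 , 0 , 3) ∷ (+ 10 , 0 , 1) ∷ [])
    refl refl refl refl refl

  -- Since `disc` vanishes on the diagonal, no derivative occurs: this is E₈ = E₄², and `σ₃σ₅` is
  -- likewise E₁₀ = E₄E₆.
  σ₃σ₃ :
    σσ-combination ((+ 120 , 3 , 3) ∷ []) ⊕
    θσ-combination [] ≗
    σ-combination ((- + 1 , 3) ∷ (+ 1 , 7) ∷ [])
  σ₃σ₃ = polynomial-convolution-identity
    disc (λ _ _ _ → refl)
    refl refl (+ 30)
    ((+ 120 , 3 , 3) ∷ [])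
    []
    ((- + 1 , 3) ∷ (+ 1 , 7) ∷ [])
    ((+ 10 , 4 , 3) ∷ (+ 15 , 4 , 2) ∷ (+ 5 , 4 , 1) ∷ (- + 15 , 3 , 4) ∷ (- + 30 , 3 , 3) ∷
     (- + 15 , 3 , 2) ∷ (+ 6 , 2 , 5) ∷ (+ 15 , 2 , 4) ∷ (+ 10 , 2 , 3) ∷ (- + 1 , 2 , 1) ∷ [])
    refl refl refl refl refl

  σ₃σ₅ :
    σσ-combination ((+ 2520 , 5 , 3) ∷ (+ 2520 , 3 , 5) ∷ []) ⊕
    θσ-combination [] ≗
    σ-combination ((+ 10 , 3) ∷ (- + 21 , 5) ∷ (+ 11 , 9) ∷ [])
  σ₃σ₅ = polynomial-convolution-identity
    (λ a b → norm a b :* disc a b) (λ _ _ _ → refl)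
    refl refl (+ 420)
    ((+ 2520 , 5 , 3) ∷ (+ 2520 , 3 , 5) ∷ [])
    []
    ((+ 10 , 3) ∷ (- + 21 , 5) ∷ (+ 11 , 9) ∷ [])
    ((+ 140 , 6 , 3) ∷ (+ 210 , 6 , 2) ∷ (+ 70 , 6 , 1) ∷ (- + 315 , 5 , 4) ∷ (- + 630 , 5 , 3) ∷
     (- + 315 , 5 , 2) ∷ (+ 336 , 4 , 5) ∷ (+ 840 , 4 , 4) ∷ (+ 560 , 4 , 3) ∷ (- + 56 , 4 , 1) ∷
     (- + 210 , 3 , 6) ∷ (- + 630 , 3 , 5) ∷ (- + 525 , 3 , 4) ∷ (+ 105 , 3 , 2) ∷ (+ 60 , 2 , 7) ∷
     (+ 210 , 2 , 6) ∷ (+ 210 , 2 , 5) ∷ (- + 70 , 2 , 3) ∷ (+ 10 , 2 , 1) ∷ [])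
    refl refl refl refl refl

-- The logarithmic derivative of Δ

geomθ : ℕ → Series
geomθ n = const (+ n) ⊛ geom n

-- Here θ(1 - x) = -ax, and `geom-unfold` rewrites x as u(1 - x).
θ-eulerFactor : ∀ i → let f = 1ˢ ⊖ q^ suc i in θ f ≗ ⊝ (geomθ (suc i) ⊛ f)
θ-eulerFactor i = begin
  θ (1ˢ ⊕ ⊝ x)              ≈⟨ θ-⊕ 1ˢ (⊝ x) ⟩
  θ 1ˢ ⊕ θ (⊝ x)            ≈⟨ S.+-cong θ1 (θ-⊝ x) ⟩
  const 0ℤ ⊕ ⊝ θ x
    ≈⟨ S.+-cong (S.refl {const 0ℤ}) (S.-‿cong (S.trans {θ x} {a · x} (θ-q^ (suc i)) (S.sym (const-⊛ a x)))) ⟩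
  const 0ℤ ⊕ ⊝ (const a ⊛ x)
    ≈⟨ solve 3 (λ c x u → con 0ℤ :+ :- (c :* x) := :- (c :* (x :+ x :* u :- x :* u))) S.refl (const a) x u ⟩
  ⊝ (const a ⊛ (x ⊕ x ⊛ u S.- x ⊛ u))
    ≈⟨ S.-‿cong (S.*-cong (S.refl {const a}) (S.+-cong (S.sym (geom-unfold i)) (S.refl {⊝ (x ⊛ u)}))) ⟩
  ⊝ (const a ⊛ (u S.- x ⊛ u))
    ≈⟨ solve 3 (λ c x u → :- (c :* (u :- x :* u)) := :- (c :* u :* (con 1ℤ :- x))) S.refl (const a) x u ⟩
  ⊝ (const a ⊛ u ⊛ (const 1ℤ S.- x))
    ≈⟨ S.-‿cong (S.*-cong (S.refl {const a ⊛ u}) (S.+-cong (λ m → ℤ.*-identityˡ (1ˢ m)) (S.refl {⊝ x}))) ⟩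
  ⊝ (const a ⊛ u ⊛ (1ˢ ⊕ ⊝ x)) ∎
  where
  open SetoidReasoning S.setoid
  open SeriesSolver
  a = + suc i
  x = q^ suc i
  u = geom (suc i)
  θ1 : θ 1ˢ ≗ const 0ℤ
  θ1 m = trans (trans (cong (λ x → + m * x) (sym (ℤ.*-identityˡ (1ˢ m)))) (θ-const 1ℤ m))
               (sym (ℤ.*-zeroˡ (1ˢ m)))

const-suc : ∀ k → const (+ suc k) ≗ const 1ℤ ⊕ const (+ k)
const-suc k m = ℤ.*-distribʳ-+ (1ˢ m) 1ℤ (+ k)

θ-^ˢ : ∀ {f w} → θ f ≗ ⊝ (w ⊛ f) → ∀ k → θ (f ^ˢ k) ≗ ⊝ (const (+ k) ⊛ (w ⊛ f ^ˢ k))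
θ-^ˢ {f} {w} θf zero = begin
  θ 1ˢ                        ≈⟨ θ-cong (λ m → sym (ℤ.*-identityˡ (1ˢ m))) ⟩
  θ (const 1ℤ)                ≈⟨ θ-const 1ℤ ⟩
  0ˢ                          ≈⟨ (λ m → sym (ℤ.*-zeroˡ (1ˢ m))) ⟩
  const 0ℤ                    ≈⟨ solve 1 (λ w → con 0ℤ := :- (con 0ℤ :* w)) S.refl (w ⊛ 1ˢ) ⟩
  ⊝ (const 0ℤ ⊛ (w ⊛ 1ˢ))     ∎
  where
  open SetoidReasoning S.setoid
  open SeriesSolver
θ-^ˢ {f} {w} θf (suc k) = begin
  θ (f ⊛ f ^ˢ k)                    ≈⟨ θ-⊛ f (f ^ˢ k) ⟩
  θ f ⊛ f ^ˢ k ⊕ f ⊛ θ (f ^ˢ k)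
    ≈⟨ S.+-cong (S.*-cong θf (S.refl {f ^ˢ k})) (S.*-cong (S.refl {f}) (θ-^ˢ {f} {w} θf k)) ⟩
  ⊝ (w ⊛ f) ⊛ f ^ˢ k ⊕ f ⊛ ⊝ (const (+ k) ⊛ (w ⊛ f ^ˢ k))
    ≈⟨ solve 4 (λ w f g c → :- (w :* f) :* g :+ f :* :- (c :* (w :* g))
                         := :- ((con 1ℤ :+ c) :* (w :* (f :* g)))) S.refl w f (f ^ˢ k) (const (+ k)) ⟩
  ⊝ ((const 1ℤ ⊕ const (+ k)) ⊛ (w ⊛ (f ⊛ f ^ˢ k)))
    ≈⟨ S.-‿cong (S.*-cong (S.sym (const-suc k)) (S.refl {w ⊛ (f ⊛ f ^ˢ k)})) ⟩
  ⊝ (const (+ suc k) ⊛ (w ⊛ (f ⊛ f ^ˢ k))) ∎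
  where
  open SetoidReasoning S.setoid
  open SeriesSolver

θ-⊛-logarithmic : ∀ {f g w W c} →
  θ f ≗ ⊝ (const c ⊛ (w ⊛ f)) → θ g ≗ ⊝ (const c ⊛ (W ⊛ g)) →
  θ (f ⊛ g) ≗ ⊝ (const c ⊛ ((w ⊕ W) ⊛ (f ⊛ g)))
θ-⊛-logarithmic {f} {g} {w} {W} {c} θf θg = begin
  θ (f ⊛ g)                   ≈⟨ θ-⊛ f g ⟩
  θ f ⊛ g ⊕ f ⊛ θ g           ≈⟨ S.+-cong (S.*-cong θf (S.refl {g})) (S.*-cong (S.refl {f}) θg) ⟩
  ⊝ (const c ⊛ (w ⊛ f)) ⊛ g ⊕ f ⊛ ⊝ (const c ⊛ (W ⊛ g))
    ≈⟨ solve 5 (λ c w W f g → :- (c :* (w :* f)) :* g :+ f :* :- (c :* (W :* g))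
                         := :- (c :* ((w :+ W) :* (f :* g)))) S.refl (const c) w W f g ⟩
  ⊝ (const c ⊛ ((w ⊕ W) ⊛ (f ⊛ g))) ∎
  where
  open SetoidReasoning S.setoid
  open SeriesSolver

-- The product on ℤ unfolds on its arguments, twice each, so comparing terms
-- that mention eulerFactor²⁴ must not unfold its 24 nested products: the power
-- enters through an equation.
θ-power : ∀ {f w} → θ f ≗ ⊝ (w ⊛ f) → ∀ k {g} → g ≡ f ^ˢ k → θ g ≗ ⊝ (const (+ k) ⊛ (w ⊛ g))
θ-power {f} {w} θf k refl = θ-^ˢ {f} {w} θf k

eulerFactor²⁴-power : ∀ n → eulerFactor²⁴ n ≡ (1ˢ ⊖ q^ n) ^ˢ 24
eulerFactor²⁴-power n = refl

θ-eulerFactor²⁴ : ∀ N → θ (eulerFactor²⁴ (suc N)) ≗ ⊝ (const (+ 24) ⊛ (geomθ (suc N) ⊛ eulerFactor²⁴ (suc N)))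
θ-eulerFactor²⁴ N = θ-power {1ˢ ⊖ q^ suc N} {geomθ (suc N)} (θ-eulerFactor N) 24
  {eulerFactor²⁴ (suc N)} (eulerFactor²⁴-power (suc N))

∑geomθ : ℕ → Series
∑geomθ zero    = const 0ℤ
∑geomθ (suc N) = geomθ (suc N) ⊕ ∑geomθ N

∑geomθ-σ : ∀ {N m} → m ≤ N → ∑geomθ N m ≡ σˢ 1 m
∑geomθ-σ {N} {m} m≤N = trans (as-Σ N) (sym (σ-geom 1 m≤N))
  where
  as-Σ : ∀ N → ∑geomθ N m ≡ Σ< N (λ i → (+ suc i) ^ 1 * geom (suc i) m)
  as-Σ zero    = ℤ.*-zeroˡ (1ˢ m)
  as-Σ (suc N) = trans (ℤ.+-comm (geomθ (suc N) m) (∑geomθ N m)) (trans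
    (cong₂ _+_ (as-Σ N) (trans (const-⊛ (+ suc N) (geom (suc N)) m)
                               (cong (λ x → x * geom (suc N) m) (sym (ℤ.*-identityʳ (+ suc N))))))
    (sym (Σ-last N (λ i → (+ suc i) ^ 1 * geom (suc i) m))))

module _ {F : ℕ → Series} {c : ℤ}
  (θF : ∀ N → θ (F (suc N)) ≗ ⊝ (const c ⊛ (geomθ (suc N) ⊛ F (suc N))))
  where

  θ-∏ : ∀ N → θ (∏[1⋯ N ] F) ≗ ⊝ (const c ⊛ (∑geomθ N ⊛ ∏[1⋯ N ] F))
  θ-∏ zero = begin
    θ 1ˢ                                 ≈⟨ θ-cong (λ m → sym (ℤ.*-identityˡ (1ˢ m))) ⟩
    θ (const 1ℤ)                         ≈⟨ θ-const 1ℤ ⟩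
    0ˢ                                   ≈⟨ (λ m → sym (ℤ.*-zeroˡ (1ˢ m))) ⟩
    const 0ℤ
      ≈⟨ solve 2 (λ c u → con 0ℤ := :- (c :* (con 0ℤ :* u))) S.refl (const c) 1ˢ ⟩
    ⊝ (const c ⊛ (const 0ℤ ⊛ 1ˢ))        ∎
    where
    open SetoidReasoning S.setoid
    open SeriesSolver
  θ-∏ (suc N) = θ-⊛-logarithmic {F (suc N)} {∏[1⋯ N ] F} {geomθ (suc N)} {∑geomθ N} {c} (θF N) (θ-∏ N)

  -- In degree `m` the infinite product is its m-th partial product by definition. `θ-∏` applies
  -- there, and truncated sum and product agree with `σˢ 1` and `∏∞ F` in all degrees up to `m`.
  θ-∏∞ : (∀ n → OneMod-q^ n (F n)) → θ (∏∞ F) ≗ ⊝ (const c ⊛ (σˢ 1 ⊛ ∏∞ F))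
  θ-∏∞ F≡1 m = trans (θ-∏ m m) (cong -_ (⊛-cong-≤ {f = const c} m (λ _ _ → refl)
    (λ i i≤m → ⊛-cong-≤ {f = ∑geomθ m} i
      (λ j j≤i → ∑geomθ-σ (ℕ.≤-trans j≤i i≤m))
      (λ j j≤i → ∏∞-limit F F≡1 (ℕ.≤-trans j≤i i≤m)))))

θ-q⊛ : ∀ {η c s} → θ η ≗ ⊝ (const c ⊛ (s ⊛ η)) →
       θ (q^ 1 ⊛ η) ≗ (const 1ℤ ⊕ ⊝ (const c ⊛ s)) ⊛ (q^ 1 ⊛ η)
θ-q⊛ {η} {c} {s} θη = begin
  θ (x ⊛ η)               ≈⟨ θ-⊛ x η ⟩
  θ x ⊛ η ⊕ x ⊛ θ η
    ≈⟨ S.+-cong (S.*-cong (S.trans {θ x} {1ℤ · x} (θ-q^ 1) (λ m → ℤ.*-identityˡ (x m))) (S.refl {η}))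
                (S.*-cong (S.refl {x}) θη) ⟩
  x ⊛ η ⊕ x ⊛ ⊝ (const c ⊛ (s ⊛ η))
    ≈⟨ solve 4 (λ x η c s → x :* η :+ x :* :- (c :* (s :* η))
                         := (con 1ℤ :- c :* s) :* (x :* η)) S.refl x η (const c) s ⟩
  (const 1ℤ S.- const c ⊛ s) ⊛ (x ⊛ η) ∎
  where
  open SetoidReasoning S.setoid
  open SeriesSolver
  x = q^ 1

-- The factor is E₂, in the exact form denoted by the polynomial `E₂` below.
θ-Δ : θ Δ ≗ (const 1ℤ ⊕ ⊝ (const (+ 24) ⊛ σˢ 1)) ⊛ Δ
θ-Δ = θ-q⊛ {∏∞ eulerFactor²⁴} {+ 24} {σˢ 1} (θ-∏∞ {eulerFactor²⁴} {+ 24} θ-eulerFactor²⁴ eulerFactor²⁴-OneMod)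

-- As P has constant term 1, comparing coefficients gives (m - 1) W_m = Σ_{j<m} P_{m-j} W_j. For m ≥
-- 2 the factor m - 1 can be cancelled, so vanishing propagates from degrees 0 and 1.
θ-unique : ∀ {P W} → P 0 ≡ 1ℤ → θ W ≗ P ⊛ W → W 0 ≡ 0ℤ → W 1 ≡ 0ℤ → W ≗ 0ˢ
θ-unique {P} {W} P₀≡1 θW W₀≡0 W₁≡0 m = vanishes m m ℕ.≤-refl
  where
  shift : ∀ a w → a * w ≡ (1ℤ + a) * w - w
  shift = solve 2 (λ a w → a :* w := (con 1ℤ :+ a) :* w :- w) refl
    where open +-*-Solver

  step : ∀ i → (∀ j → j ≤ suc i → W j ≡ 0ℤ) → W (suc (suc i)) ≡ 0ℤ
  step i W≡0 = ℤ.*-cancelˡ-≡ (+ suc i) w 0ℤ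
    (trans (shift (+ suc i) w) (trans (ℤ.i≡j⇒i-j≡0 euler) (sym (ℤ.*-zeroʳ (+ suc i)))))
    where
    w = W (suc (suc i))
    euler : + suc (suc i) * w ≡ w
    euler = trans (θW (suc (suc i))) (trans
      (cong₂ _+_ (trans (cong (λ x → x * w) P₀≡1) (ℤ.*-identityˡ w))
        (trans (⊛-cong-≤ {f = tail P} {g′ = 0ˢ} (suc i) (λ _ _ → refl) W≡0)
               (S.zeroʳ (tail P) (suc i))))
      (ℤ.+-identityʳ w))

  vanishes : ∀ m i → i ≤ m → W i ≡ 0ℤ
  vanishes m       zero          i≤m       = W₀≡0
  vanishes m       (suc zero)    i≤m       = W₁≡0
  vanishes (suc m) (suc (suc i)) (s≤s i≤m) =
    step i (λ j j≤1+i → vanishes m j (ℕ.≤-trans j≤1+i i≤m))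

solve-remainder : ∀ x y k m → x + -1ℤ * (y + m * k) ≡ 0ℤ → x - y ≡ k * m
solve-remainder x y k m ≡0 = begin
  x - y                              ≡⟨ solve 4 (λ x y k m → x :- y
                                          := x :+ con -1ℤ :* (y :+ m :* k) :+ k :* m) refl x y k m ⟩
  x + -1ℤ * (y + m * k) + k * m      ≡⟨ cong (λ z → z + k * m) ≡0 ⟩
  0ℤ + k * m                         ≡⟨ ℤ.+-identityˡ (k * m) ⟩
  k * m                              ∎
  where
  open ≡-Reasoning
  open +-*-Solver

-- Polynomials in S₁, S₃, S₅

module RamanujanRing where

  open Convolutions using (σ₁σ₁; σ₁σ₃; σ₁σ₅-σ₃σ₃; σ₃σ₃; σ₃σ₅)
  open SeriesSolver
  open SetoidReasoning S.setoid

  ρ : Env 3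
  ρ = σˢ 1 ∷ σˢ 3 ∷ σˢ 5 ∷ []

  p̂ q̂ r̂ : Polynomial 3
  p̂ = var 0F
  q̂ = var 1F
  r̂ = var 2F

  const-⊛-cancel : ∀ c .{{_ : ℤ.NonZero c}} {f g} → const c ⊛ f ≗ const c ⊛ g → f ≗ g
  const-⊛-cancel c {f} {g} cf≗cg m = ℤ.*-cancelˡ-≡ c (f m) (g m)
    (trans (sym (const-⊛ c f m)) (trans (cf≗cg m) (const-⊛ c g m)))

  const-* : ∀ c d → const (c * d) ≗ const c ⊛ const d
  const-* c d m = trans (ℤ.*-assoc c d (1ˢ m)) (sym (const-⊛ c (const d) m))

  infix 4 _≋ˢ_

  _≋ˢ_ : ∀ {m} → Polynomial m → Polynomial m → Set
  p ≋ˢ q = normalise p ≡ normalise q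

  ≋ˢ-sound : ∀ {m} (p q : Polynomial m) → p ≋ˢ q → ∀ ρ → ⟦ p ⟧ ρ ≗ ⟦ q ⟧ ρ
  ≋ˢ-sound p q p≋q ρ = prove ρ p q (λ i → cong (λ nf → ⟦ nf ⟧N ρ i) p≋q)

  -- A certificate that x - y lies in the ideal of the relations a - b and c - d, with cofactors `k`
  -- and `l`. Where one relation suffices, the second is trivial with cofactor 0.
  by-relations : ∀ {m} (ρ : Env m) (x y k a b l c d : Polynomial m) →
    ⟦ a ⟧ ρ ≗ ⟦ b ⟧ ρ → ⟦ c ⟧ ρ ≗ ⟦ d ⟧ ρ →
    x ≋ˢ y :+ k :* (a :- b) :+ l :* (c :- d) → ⟦ x ⟧ ρ ≗ ⟦ y ⟧ ρ
  by-relations ρ x y k a b l c d a≗b c≗d x≋ = begin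
    ⟦ x ⟧ ρ
      ≈⟨ ≋ˢ-sound x (y :+ k :* (a :- b) :+ l :* (c :- d)) x≋ ρ ⟩
    ⟦ y ⟧ ρ ⊕ ⟦ k ⟧ ρ ⊛ (⟦ a ⟧ ρ S.- ⟦ b ⟧ ρ) ⊕ ⟦ l ⟧ ρ ⊛ (⟦ c ⟧ ρ S.- ⟦ d ⟧ ρ)
      ≈⟨ S.+-cong (S.+-cong (S.refl {⟦ y ⟧ ρ}) (S.*-cong (S.refl {⟦ k ⟧ ρ}) (S.+-cong a≗b (S.refl {⊝ ⟦ b ⟧ ρ}))))
                  (S.*-cong (S.refl {⟦ l ⟧ ρ}) (S.+-cong c≗d (S.refl {⊝ ⟦ d ⟧ ρ}))) ⟩
    ⟦ y ⟧ ρ ⊕ ⟦ k ⟧ ρ ⊛ (⟦ b ⟧ ρ S.- ⟦ b ⟧ ρ) ⊕ ⟦ l ⟧ ρ ⊛ (⟦ d ⟧ ρ S.- ⟦ d ⟧ ρ)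
      ≈⟨ solve 5 (λ y k b l d → y :+ k :* (b :- b) :+ l :* (d :- d) := y)
           S.refl (⟦ y ⟧ ρ) (⟦ k ⟧ ρ) (⟦ b ⟧ ρ) (⟦ l ⟧ ρ) (⟦ d ⟧ ρ) ⟩
    ⟦ y ⟧ ρ ∎

  -- derivative i is 420 θ Sₖ for k = 1, 3, 5, by Ramanujan's differential equations.
  derivative : Fin 3 → Polynomial 3
  derivative 0F = con (+ 70) :* (p̂ :+ con (+ 5) :* q̂ :- con (+ 12) :* (p̂ :* p̂))
  derivative 1F = con (+ 14) :* (con (+ 10) :* q̂ :+ con (+ 21) :* r̂ :- p̂ :- con (+ 240) :* (p̂ :* q̂))
  derivative 2F = con (+ 10) :*
    (p̂ :+ con (+ 20) :* q̂ :+ con (+ 21) :* r̂ :+ con (+ 2400) :* (q̂ :* q̂) :- con (+ 504) :* (p̂ :* r̂))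

  -- The scale 420 is the least common multiple of the coefficients 6, 30 and 420 of θ in the three
  -- convolution identities. Using it for all variables makes 420 θ a derivation of integral
  -- polynomials.
  derive : Polynomial 3 → Polynomial 3
  derive (op [+] p q)  = derive p :+ derive q
  derive (op [*] p q)  = derive p :* q :+ p :* derive q
  derive (con c)       = con 0ℤ
  derive (var i)       = derivative i
  derive (p :^ zero)   = con 0ℤ
  derive (p :^ suc n)  = derive p :* p :^ n :+ p :* derive (p :^ n)
  derive (:- p)        = :- derive p

  σ₇-expand : σˢ 7 ≗ ⟦ q̂ :+ con (+ 120) :* (q̂ :* q̂) ⟧ ρ
  σ₇-expand = by-relations (σˢ 3 ∷ σˢ 7 ∷ []) s (q :+ con (+ 120) :* (q :* q))
    (con -1ℤ) (con (+ 120) :* (q :* q) :+ con 0ℤ :+ con 0ℤ) (con -1ℤ :* q :+ (con (+ 1) :* s :+ con 0ℤ))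
    (con 0ℤ) s s σ₃σ₃ (S.refl {σˢ 7}) refl
    where
    q s : Polynomial 2
    q = var 0F
    s = var 1F

  σ₉-expand : const (+ 11) ⊛ σˢ 9 ≗ ⟦ con (+ 21) :* r̂ :- con (+ 10) :* q̂ :+ con (+ 5040) :* (q̂ :* r̂) ⟧ ρ
  σ₉-expand = by-relations (σˢ 3 ∷ σˢ 5 ∷ σˢ 9 ∷ [])
    (con (+ 11) :* t) (con (+ 21) :* r :- con (+ 10) :* q :+ con (+ 5040) :* (q :* r))
    (con -1ℤ)
    (con (+ 2520) :* (r :* q) :+ (con (+ 2520) :* (q :* r) :+ con 0ℤ) :+ con 0ℤ)
    (con (+ 10) :* q :+ (con (- + 21) :* r :+ (con (+ 11) :* t :+ con 0ℤ)))
    (con 0ℤ) t t σ₃σ₅ (S.refl {σˢ 9}) refl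
    where
    q r t : Polynomial 3
    q = var 0F
    r = var 1F
    t = var 2F

  θ-var : ∀ i → const (+ 420) ⊛ θ (lookup ρ i) ≗ ⟦ derivative i ⟧ ρ
  θ-var 0F = by-relations (σˢ 1 ∷ σˢ 3 ∷ θ (σˢ 1) ∷ [])
    (con (+ 420) :* d) (con (+ 70) :* (p :+ con (+ 5) :* q :- con (+ 12) :* (p :* p)))
    (con (+ 70))
    (con (+ 12) :* (p :* p) :+ con 0ℤ :+ (con (+ 6) :* d :+ con 0ℤ))
    (con (+ 1) :* p :+ (con (+ 5) :* q :+ con 0ℤ))
    (con 0ℤ) p p σ₁σ₁ (S.refl {σˢ 1}) refl
    where
    p q d : Polynomial 3
    p = var 0F
    q = var 1F
    d = var 2F
  θ-var 1F = by-relations (σˢ 1 ∷ σˢ 3 ∷ σˢ 5 ∷ θ (σˢ 3) ∷ [])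
    (con (+ 420) :* d) (con (+ 14) :* (con (+ 10) :* q :+ con (+ 21) :* r :- p :- con (+ 240) :* (p :* q)))
    (con (+ 14))
    (con (+ 120) :* (q :* p) :+ (con (+ 120) :* (p :* q) :+ con 0ℤ) :+ (con (+ 30) :* d :+ con 0ℤ))
    (con -1ℤ :* p :+ (con (+ 10) :* q :+ (con (+ 21) :* r :+ con 0ℤ)))
    (con 0ℤ) p p σ₁σ₃ (S.refl {σˢ 1}) refl
    where
    p q r d : Polynomial 4
    p = var 0F
    q = var 1F
    r = var 2F
    d = var 3F
  θ-var 2F = by-relations (σˢ 1 ∷ σˢ 3 ∷ σˢ 5 ∷ σˢ 7 ∷ θ (σˢ 5) ∷ [])
    (con (+ 420) :* d)
    (con (+ 10) :* (p :+ con (+ 20) :* q :+ con (+ 21) :* r :+ con (+ 2400) :* (q :* q) :- con (+ 504) :* (p :* r)))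
    (con 1ℤ)
    (con (+ 2520) :* (r :* p) :+ (con (+ 5880) :* (q :* q) :+ (con (+ 2520) :* (p :* r) :+ con 0ℤ))
      :+ (con (+ 420) :* d :+ con 0ℤ))
    (con (+ 10) :* p :+ (con (- + 49) :* q :+ (con (+ 210) :* r :+ (con (+ 249) :* s :+ con 0ℤ))))
    -- The cofactor 249 is the coefficient of S₇ that remains to be eliminated.
    (con (+ 249)) s (q :+ con (+ 120) :* (q :* q)) σ₁σ₅-σ₃σ₃ σ₇-expand refl
    where
    p q r s d : Polynomial 5
    p = var 0F
    q = var 1F
    r = var 2F
    s = var 3F
    d = var 4F

  θ-derive : ∀ e → const (+ 420) ⊛ θ (⟦ e ⟧ ρ) ≗ ⟦ derive e ⟧ ρ

  -- Separated from `θ-derive` because successor powers also evaluate to products.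
  θ-derive-⊛ : ∀ e e′ → const (+ 420) ⊛ θ (⟦ e ⟧ ρ ⊛ ⟦ e′ ⟧ ρ) ≗ ⟦ derive e :* e′ :+ e :* derive e′ ⟧ ρ
  θ-derive-⊛ e e′ = begin
    const (+ 420) ⊛ θ (f ⊛ g)                 ≈⟨ S.*-cong (S.refl {const (+ 420)}) (θ-⊛ f g) ⟩
    const (+ 420) ⊛ (θ f ⊛ g ⊕ f ⊛ θ g)
      ≈⟨ solve 5 (λ c f g f′ g′ → c :* (f′ :* g :+ f :* g′) := c :* f′ :* g :+ f :* (c :* g′))
           S.refl (const (+ 420)) f g (θ f) (θ g) ⟩
    const (+ 420) ⊛ θ f ⊛ g ⊕ f ⊛ (const (+ 420) ⊛ θ g)
      ≈⟨ S.+-cong (S.*-cong (θ-derive e) (S.refl {g})) (S.*-cong (S.refl {f}) (θ-derive e′)) ⟩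
    ⟦ derive e ⟧ ρ ⊛ g ⊕ f ⊛ ⟦ derive e′ ⟧ ρ  ∎
    where
    f = ⟦ e ⟧ ρ
    g = ⟦ e′ ⟧ ρ

  θ-derive (op [+] e e′) = begin
    const (+ 420) ⊛ θ (f ⊕ g)                 ≈⟨ S.*-cong (S.refl {const (+ 420)}) (θ-⊕ f g) ⟩
    const (+ 420) ⊛ (θ f ⊕ θ g)
      ≈⟨ S.distribˡ (const (+ 420)) (θ f) (θ g) ⟩
    const (+ 420) ⊛ θ f ⊕ const (+ 420) ⊛ θ g ≈⟨ S.+-cong (θ-derive e) (θ-derive e′) ⟩
    ⟦ derive e ⟧ ρ ⊕ ⟦ derive e′ ⟧ ρ          ∎
    where
    f = ⟦ e ⟧ ρ
    g = ⟦ e′ ⟧ ρ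
  θ-derive (op [*] e e′) = θ-derive-⊛ e e′
  θ-derive (con c) = begin
    const (+ 420) ⊛ θ (const c)   ≈⟨ S.*-cong (S.refl {const (+ 420)}) (θ-const c) ⟩
    const (+ 420) ⊛ 0ˢ            ≈⟨ S.zeroʳ (const (+ 420)) ⟩
    0ˢ                            ≈⟨ S.sym const-0 ⟩
    const 0ℤ                      ∎
  θ-derive (var i) = θ-var i
  θ-derive (e :^ zero) = begin
    const (+ 420) ⊛ θ 1ˢ
      ≈⟨ S.*-cong (S.refl {const (+ 420)}) (θ-cong {1ˢ} {const 1ℤ} (λ m → sym (ℤ.*-identityˡ (1ˢ m)))) ⟩
    const (+ 420) ⊛ θ (const 1ℤ)  ≈⟨ S.*-cong (S.refl {const (+ 420)}) (θ-const 1ℤ) ⟩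
    const (+ 420) ⊛ 0ˢ            ≈⟨ S.zeroʳ (const (+ 420)) ⟩
    0ˢ                            ≈⟨ S.sym const-0 ⟩
    const 0ℤ                      ∎
  θ-derive (e :^ suc n) = θ-derive-⊛ e (e :^ n)
  θ-derive (:- e) = begin
    const (+ 420) ⊛ θ (⊝ f)       ≈⟨ S.*-cong (S.refl {const (+ 420)}) (θ-⊝ f) ⟩
    const (+ 420) ⊛ ⊝ θ f
      ≈⟨ solve 2 (λ c f → c :* :- f := :- (c :* f)) S.refl (const (+ 420)) (θ f) ⟩
    ⊝ (const (+ 420) ⊛ θ f)       ≈⟨ S.-‿cong (θ-derive e) ⟩
    ⊝ ⟦ derive e ⟧ ρ              ∎
    where f = ⟦ e ⟧ ρ

  E₂ E₄ E₆ discriminant : Polynomial 3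
  E₂ = con 1ℤ :- con (+ 24) :* p̂
  E₄ = con 1ℤ :+ con (+ 240) :* q̂
  E₆ = con 1ℤ :- con (+ 504) :* r̂
  discriminant = E₄ :* E₄ :* E₄ :- E₆ :* E₆

  θ-eigen : ∀ p e → derive e ≋ˢ con (+ 420) :* (p :* e) → θ (⟦ e ⟧ ρ) ≗ ⟦ p :* e ⟧ ρ
  θ-eigen p e e≋ = const-⊛-cancel (+ 420) {θ (⟦ e ⟧ ρ)} {⟦ p :* e ⟧ ρ}
    (S.trans {const (+ 420) ⊛ θ (⟦ e ⟧ ρ)} {⟦ derive e ⟧ ρ} (θ-derive e)
      (≋ˢ-sound (derive e) (con (+ 420) :* (p :* e)) e≋ ρ))

  -- By Ramanujan's equations 3E₄²θE₄ = E₂E₄³ - E₄²E₆ and 2E₆θE₆ = E₂E₆² - E₄²E₆, and the terms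
  -- E₄²E₆ cancel.
  θ-discriminant : θ (⟦ discriminant ⟧ ρ) ≗ ⟦ E₂ :* discriminant ⟧ ρ
  θ-discriminant = θ-eigen E₂ discriminant refl

  module _ {T : Series} (θT : θ T ≗ ⟦ E₂ ⟧ ρ ⊛ T) where

    -- The equation θf = E₂f is linear. An abstract solution `T` keeps the 24th powers inside `Δ`
    -- out of the terms compared.
    θ-difference : let W = const (+ 1728) ⊛ T S.- ⟦ discriminant ⟧ ρ in θ W ≗ ⟦ E₂ ⟧ ρ ⊛ W
    θ-difference = begin
      θ (c ⊛ T ⊕ ⊝ d)             ≈⟨ θ-⊕ (c ⊛ T) (⊝ d) ⟩
      θ (c ⊛ T) ⊕ θ (⊝ d)         ≈⟨ S.+-cong (θ-⊛ c T) (θ-⊝ d) ⟩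
      θ c ⊛ T ⊕ c ⊛ θ T ⊕ ⊝ θ d
        ≈⟨ S.+-cong (S.+-cong (S.*-cong (S.trans {θ c} (θ-const (+ 1728)) (S.sym const-0)) (S.refl {T})) (S.*-cong (S.refl {c}) θT))
                    (S.-‿cong θ-discriminant) ⟩
      const 0ℤ ⊛ T ⊕ c ⊛ (e ⊛ T) ⊕ ⊝ (e ⊛ d)
        ≈⟨ solve 4 (λ c e T d → con 0ℤ :* T :+ c :* (e :* T) :+ :- (e :* d) := e :* (c :* T :- d))
             S.refl c e T d ⟩
      e ⊛ (c ⊛ T ⊕ ⊝ d) ∎
      where
      c d e : Series
      c = const (+ 1728)
      d = ⟦ discriminant ⟧ ρ
      e = ⟦ E₂ ⟧ ρ

    1728T : (const (+ 1728) ⊛ T S.- ⟦ discriminant ⟧ ρ) 0 ≡ 0ℤ →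
            (const (+ 1728) ⊛ T S.- ⟦ discriminant ⟧ ρ) 1 ≡ 0ℤ →
            const (+ 1728) ⊛ T ≗ ⟦ discriminant ⟧ ρ
    1728T W₀ W₁ m = ℤ.i-j≡0⇒i≡j _ _
      (θ-unique {⟦ E₂ ⟧ ρ} {const (+ 1728) ⊛ T S.- ⟦ discriminant ⟧ ρ} refl θ-difference W₀ W₁ m)

  1728Δ : const (+ 1728) ⊛ Δ ≗ ⟦ discriminant ⟧ ρ
  -- Degrees 0 and 1 are computed; in degree 1 the discriminant has coefficient 3 · 240 + 2 · 504 =
  -- 1728.
  1728Δ = 1728T {Δ} θ-Δ refl refl

  -- Every series below has, up to a nonzero integer factor, an expression as a
  -- polynomial in S₁, S₃, S₅, so that its vanishing is decidable.
  record Scaled (f : Series) : Set where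
    constructor scaled
    field
      scale           : ℤ
      {{scale≢0}}     : ℤ.NonZero scale
      numerator       : Polynomial 3
      scale⊛≗         : const scale ⊛ f ≗ ⟦ numerator ⟧ ρ

  open Scaled

  scaled-var : ∀ i → Scaled (lookup ρ i)
  scaled-var i = scaled 1ℤ (con 1ℤ :* var i) (S.refl {const 1ℤ ⊛ lookup ρ i})

  scaled-⊛ : ∀ {f g} → Scaled f → Scaled g → Scaled (f ⊛ g)
  scaled-⊛ {f} {g} (scaled c p cf) (scaled d q dg) = scaled (c * d) {{ℤ.i*j≢0 c d}} (p :* q) (begin
    const (c * d) ⊛ (f ⊛ g)          ≈⟨ S.*-cong (const-* c d) (S.refl {f ⊛ g}) ⟩
    (const c ⊛ const d) ⊛ (f ⊛ g)
      ≈⟨ solve 4 (λ c d f g → c :* d :* (f :* g) := c :* f :* (d :* g)) S.refl (const c) (const d) f g ⟩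
    (const c ⊛ f) ⊛ (const d ⊛ g)    ≈⟨ S.*-cong cf dg ⟩
    ⟦ p ⟧ ρ ⊛ ⟦ q ⟧ ρ                ∎)

  scaled-⊕ : ∀ {f g} → Scaled f → Scaled g → Scaled (f ⊕ g)
  scaled-⊕ {f} {g} (scaled c p cf) (scaled d q dg) = scaled (c * d) {{ℤ.i*j≢0 c d}} (con d :* p :+ con c :* q) (begin
    const (c * d) ⊛ (f ⊕ g)          ≈⟨ S.*-cong (const-* c d) (S.refl {f ⊕ g}) ⟩
    (const c ⊛ const d) ⊛ (f ⊕ g)
      ≈⟨ solve 4 (λ c d f g → c :* d :* (f :+ g) := d :* (c :* f) :+ c :* (d :* g))
           S.refl (const c) (const d) f g ⟩
    const d ⊛ (const c ⊛ f) ⊕ const c ⊛ (const d ⊛ g)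
                                     ≈⟨ S.+-cong (S.*-cong (S.refl {const d}) cf) (S.*-cong (S.refl {const c}) dg) ⟩
    const d ⊛ ⟦ p ⟧ ρ ⊕ const c ⊛ ⟦ q ⟧ ρ ∎)

  scaled-const : ∀ c → Scaled (const c)
  scaled-const c = scaled 1ℤ (con 1ℤ :* con c) (S.refl {const 1ℤ ⊛ const c})

  scaled-θ : ∀ {f} → Scaled f → Scaled (θ f)
  scaled-θ {f} (scaled c p cf) = scaled (+ 420 * c) {{ℤ.i*j≢0 (+ 420) c}} (derive p) (begin
    const (+ 420 * c) ⊛ θ f                 ≈⟨ S.*-cong (const-* (+ 420) c) (S.refl {θ f}) ⟩
    (const (+ 420) ⊛ const c) ⊛ θ f
      -- The zero term becomes θ(const c) f, so that the product rule can be read backwards to move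
      -- `const c` under θ.
      ≈⟨ solve 4 (λ k c f f′ → k :* c :* f′ := k :* (con 0ℤ :* f :+ c :* f′))
           S.refl (const (+ 420)) (const c) f (θ f) ⟩
    const (+ 420) ⊛ (const 0ℤ ⊛ f ⊕ const c ⊛ θ f)
      ≈⟨ S.*-cong (S.refl {const (+ 420)}) (S.+-cong (S.*-cong (S.trans {const 0ℤ} const-0 (S.sym (θ-const c))) (S.refl {f})) (S.refl {const c ⊛ θ f})) ⟩
    const (+ 420) ⊛ (θ (const c) ⊛ f ⊕ const c ⊛ θ f)
      ≈⟨ S.*-cong (S.refl {const (+ 420)}) (S.sym (θ-⊛ (const c) f)) ⟩
    const (+ 420) ⊛ θ (const c ⊛ f)         ≈⟨ S.*-cong (S.refl {const (+ 420)}) (θ-cong cf) ⟩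
    const (+ 420) ⊛ θ (⟦ p ⟧ ρ)             ≈⟨ θ-derive p ⟩
    ⟦ derive p ⟧ ρ                          ∎)

  scaled-zero : ∀ {f} (s : Scaled f) → numerator s ≋ˢ con 0ℤ → f ≗ 0ˢ
  scaled-zero {f} (scaled c p cf) p≋0 = const-⊛-cancel c {f} {0ˢ} (begin
    const c ⊛ f       ≈⟨ cf ⟩
    ⟦ p ⟧ ρ           ≈⟨ ≋ˢ-sound p (con 0ℤ) p≋0 ρ ⟩
    const 0ℤ          ≈⟨ const-0 ⟩
    0ˢ                ≈⟨ S.zeroʳ (const c) ⟨
    const c ⊛ 0ˢ      ∎)

  -- Congruences from identities between series

  θ^ : ℕ → Series → Series
  θ^ zero    f = f
  θ^ (suc j) f = θ (θ^ j f)

  θ^-coeff : ∀ j f n → θ^ j f n ≡ (+ n) ^ j * f n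
  θ^-coeff zero    f n = sym (ℤ.*-identityˡ (f n))
  θ^-coeff (suc j) f n = trans (cong (λ x → + n * x) (θ^-coeff j f n))
                               (sym (ℤ.*-assoc (+ n) ((+ n) ^ j) (f n)))

  -- The k for which a nonzero multiple of Sₖ has been written as an integral polynomial in S₁, S₃,
  -- S₅.
  data Exponent : Set where
    ₁ ₃ ₅ ₇ ₉ : Exponent

  exponent : Exponent → ℕ
  exponent ₁ = 1
  exponent ₃ = 3
  exponent ₅ = 5
  exponent ₇ = 7
  exponent ₉ = 9

  -- (j , k) stands for θʲSₖ.
  Factor : Set
  Factor = ℕ × Exponent

  ⟦_⟧ᶠ : Factor → Series
  ⟦ j , k ⟧ᶠ = θ^ j (σˢ (exponent k))

  ⟦_⟧ᴸ : List (ℤ × Factor) → Series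
  ⟦ []             ⟧ᴸ = const 0ℤ
  ⟦ (c , x) ∷ ls ⟧ᴸ = const c ⊛ ⟦ x ⟧ᶠ ⊕ ⟦ ls ⟧ᴸ

  ⟦_⟧ᴼ : List (ℤ × Factor × Factor) → Series
  ⟦ []                 ⟧ᴼ = const 0ℤ
  ⟦ (c , x , y) ∷ qs ⟧ᴼ = const c ⊛ (⟦ x ⟧ᶠ ⊛ ⟦ y ⟧ᶠ) ⊕ ⟦ qs ⟧ᴼ

  scaled-σ : ∀ k → Scaled (σˢ (exponent k))
  scaled-σ ₁ = scaled-var 0F
  scaled-σ ₃ = scaled-var 1F
  scaled-σ ₅ = scaled-var 2F
  scaled-σ ₇ = scaled 1ℤ (q̂ :+ con (+ 120) :* (q̂ :* q̂)) (S.trans {const 1ℤ ⊛ σˢ 7} {σˢ 7}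
    (S.trans {const 1ℤ ⊛ σˢ 7} (const-⊛ 1ℤ (σˢ 7)) (λ m → ℤ.*-identityˡ (σˢ 7 m))) σ₇-expand)
  scaled-σ ₉ = scaled (+ 11) (con (+ 21) :* r̂ :- con (+ 10) :* q̂ :+ con (+ 5040) :* (q̂ :* r̂)) σ₉-expand

  scaled-Δ : Scaled Δ
  scaled-Δ = scaled (+ 1728) discriminant 1728Δ

  scaled-factor : ∀ x → Scaled ⟦ x ⟧ᶠ
  scaled-factor (zero  , k) = scaled-σ k
  scaled-factor (suc j , k) = scaled-θ (scaled-factor (j , k))

  scaled-linear : ∀ ls → Scaled ⟦ ls ⟧ᴸ
  scaled-linear []             = scaled-const 0ℤ
  scaled-linear ((c , x) ∷ ls) =
    scaled-⊕ (scaled-⊛ (scaled-const c) (scaled-factor x)) (scaled-linear ls)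

  scaled-quadratic : ∀ qs → Scaled ⟦ qs ⟧ᴼ
  scaled-quadratic []                 = scaled-const 0ℤ
  scaled-quadratic ((c , x , y) ∷ qs) =
    scaled-⊕ (scaled-⊛ (scaled-const c) (scaled-⊛ (scaled-factor x) (scaled-factor y)))
             (scaled-quadratic qs)

  scaled-remainder : ∀ a ls m qs →
    Scaled (const a ⊛ Δ ⊕ const -1ℤ ⊛ (⟦ ls ⟧ᴸ ⊕ const m ⊛ ⟦ qs ⟧ᴼ))
  scaled-remainder a ls m qs = scaled-⊕ (scaled-⊛ (scaled-const a) scaled-Δ)
    (scaled-⊛ (scaled-const -1ℤ)
      (scaled-⊕ (scaled-linear ls) (scaled-⊛ (scaled-const m) (scaled-quadratic qs))))

  eval : List (ℤ × Factor) → ℕ → ℤ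
  eval []                   n = 0ℤ
  eval ((c , j , k) ∷ ls) n = c * ((+ n) ^ j * + σ (exponent k) n) + eval ls n

  ⟦⟧ᴸ-coeff : ∀ ls n → ⟦ ls ⟧ᴸ n ≡ eval ls n
  ⟦⟧ᴸ-coeff []                   n = const-0 n
  ⟦⟧ᴸ-coeff ((c , j , k) ∷ ls) n = cong₂ _+_
    (trans (const-⊛ c ⟦ j , k ⟧ᶠ n) (cong (λ x → c * x) (θ^-coeff j (σˢ (exponent k)) n)))
    (⟦⟧ᴸ-coeff ls n)

  -- The series aΔ - (linear part) - m (quadratic part) vanishes because its numerator normalises to
  -- 0. The quadratic part has integer coefficients, so its n-th one is the quotient. `y` leaves the
  -- right-hand side free in shape.
  congruence : ∀ a ls m qs → numerator (scaled-remainder (+ a) ls (+ m) qs) ≋ˢ con 0ℤ →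
               ∀ n {y} → y ≡ eval ls n → + a * τ n ≡ y [mod m ]
  congruence a ls m qs ≋0 n {y} y≡ = divides (⟦ qs ⟧ᴼ n) (solve-remainder (+ a * τ n) y (⟦ qs ⟧ᴼ n) (+ m)
    (trans (sym remainder-coeff) (scaled-zero (scaled-remainder (+ a) ls (+ m) qs) ≋0 n)))
    where
    remainder-coeff : (const (+ a) ⊛ Δ ⊕ const -1ℤ ⊛ (⟦ ls ⟧ᴸ ⊕ const (+ m) ⊛ ⟦ qs ⟧ᴼ)) n ≡
                      + a * τ n + -1ℤ * (y + + m * ⟦ qs ⟧ᴼ n)
    remainder-coeff = cong₂ _+_ (const-⊛ (+ a) Δ n)
      (trans (const-⊛ -1ℤ (⟦ ls ⟧ᴸ ⊕ const (+ m) ⊛ ⟦ qs ⟧ᴼ) n)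
             (cong (λ x → -1ℤ * x) (cong₂ _+_ (trans (⟦⟧ᴸ-coeff ls n) (sym y≡)) (const-⊛ (+ m) ⟦ qs ⟧ᴼ n))))

open RamanujanRing using (congruence; ₁; ₃; ₅; ₇; ₉)

-- In each congruence, the first list holds the right-hand side and the second
-- one the quotient of the difference of both sides by the modulus.
corollary2p8 : ∀ (n : ℕ) → n ≥ 1 →
    (+ 12 * τ n ≡ + 5 * + n * + σ 3 n + + 7 * + n * + σ 5 n
      [mod 2 ℕ.^ 3 ℕ.* 3 ℕ.* 5 ℕ.* 7 ])
  × (+ 32 * τ n ≡ + 15 * + n * + σ 1 n + + 50 * (+ n) ^ 2 * + σ 7 n - + 33 * + n * + σ 9 n
      [mod 2 ℕ.^ 5 ℕ.* 3 ℕ.^ 2 ℕ.* 5 ℕ.^ 2 ])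
  × (+ 7 * τ n ≡ + 6 * (+ n) ^ 2 * + σ 1 n - + 9 * (+ n) ^ 3 * + σ 5 n + + 10 * (+ n) ^ 2 * + σ 7 n
      [mod 2 ℕ.^ 4 ℕ.* 3 ℕ.^ 3 ℕ.* 7 ])
  × (+ 5 * τ n ≡ + 14 * (+ n) ^ 3 * + σ 1 n + + 12 * (+ n) ^ 4 * + σ 3 n - + 21 * (+ n) ^ 3 * + σ 5 n
      [mod 2 ℕ.^ 5 ℕ.* 3 ℕ.* 5 ℕ.* 7 ])
  × (+ 24 * τ n ≡ + 10 * + n * + σ 1 n + + 25 * + n * + σ 7 n - + 11 * + n * + σ 9 n
      [mod 2 ℕ.^ 3 ℕ.* 3 ℕ.* 5 ℕ.^ 2 ])
  × (+ 14 * τ n ≡ + 9 * (+ n) ^ 2 * + σ 1 n + + 5 * (+ n) ^ 2 * + σ 7 n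
      [mod 2 ℕ.^ 3 ℕ.* 3 ℕ.^ 3 ℕ.* 7 ])
  × (+ 5 * τ n ≡ + 8 * (+ n) ^ 3 * + σ 1 n - + 3 * (+ n) ^ 3 * + σ 5 n
      [mod 2 ℕ.^ 5 ℕ.* 3 ℕ.* 5 ])
  × (+ 2 * τ n ≡ (+ n) ^ 2 * + σ 1 n + (+ n) ^ 2 * + σ 5 n
      [mod 2 ℕ.^ 3 ℕ.* 3 ])
corollary2p8 n _ =
    congruence 12 ((+ 5 , 1 , ₃) ∷ (+ 7 , 1 , ₅) ∷ []) 840
    -- From the Rankin-Cohen bracket 2E₄θE₆ - 3E₆θE₄ = -1728Δ, divided by -144; the constant terms
    -- of E₄ and E₆ produce the linear part.
    ((+ 2 , (0 , ₃) , (1 , ₅)) ∷ (- + 3 , (1 , ₃) , (0 , ₅)) ∷ []) refl n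
    (solve 3 (λ n s₃ s₅ → con (+ 5) :* n :* s₃ :+ con (+ 7) :* n :* s₅
        := con (+ 5) :* (n :^ 1 :* s₃) :+ (con (+ 7) :* (n :^ 1 :* s₅) :+ con 0ℤ))
      refl (+ n) (+ σ 3 n) (+ σ 5 n))
  , congruence 32 ((+ 15 , 1 , ₁) ∷ (+ 50 , 2 , ₇) ∷ (- + 33 , 1 , ₉) ∷ []) 7200
    -- The product comes from 15 θS₁ E₈ with E₈ = 1 + 480 S₇, and 15 · 480 = 7200.
    ((+ 1 , (1 , ₁) , (0 , ₇)) ∷ []) refl n
    (solve 4 (λ n s₁ s₇ s₉ → con (+ 15) :* n :* s₁ :+ con (+ 50) :* n :^ 2 :* s₇ :- con (+ 33) :* n :* s₉
        := con (+ 15) :* (n :^ 1 :* s₁) :+ (con (+ 50) :* (n :^ 2 :* s₇) :+ (con (- + 33) :* (n :^ 1 :* s₉) :+ con 0ℤ)))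
      refl (+ n) (+ σ 1 n) (+ σ 7 n) (+ σ 9 n))
  , congruence 7 ((+ 6 , 2 , ₁) ∷ (- + 9 , 3 , ₅) ∷ (+ 10 , 2 , ₇) ∷ []) 3024
    ((- + 1 , (2 , ₁) , (0 , ₅)) ∷ []) refl n
    (solve 4 (λ n s₁ s₅ s₇ → con (+ 6) :* n :^ 2 :* s₁ :- con (+ 9) :* n :^ 3 :* s₅ :+ con (+ 10) :* n :^ 2 :* s₇
        := con (+ 6) :* (n :^ 2 :* s₁) :+ (con (- + 9) :* (n :^ 3 :* s₅) :+ (con (+ 10) :* (n :^ 2 :* s₇) :+ con 0ℤ)))
      refl (+ n) (+ σ 1 n) (+ σ 5 n) (+ σ 7 n))
  , congruence 5 ((+ 14 , 3 , ₁) ∷ (+ 12 , 4 , ₃) ∷ (- + 21 , 3 , ₅) ∷ []) 3360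
    ((+ 1 , (3 , ₁) , (0 , ₃)) ∷ []) refl n
    (solve 4 (λ n s₁ s₃ s₅ → con (+ 14) :* n :^ 3 :* s₁ :+ con (+ 12) :* n :^ 4 :* s₃ :- con (+ 21) :* n :^ 3 :* s₅
        := con (+ 14) :* (n :^ 3 :* s₁) :+ (con (+ 12) :* (n :^ 4 :* s₃) :+ (con (- + 21) :* (n :^ 3 :* s₅) :+ con 0ℤ)))
      refl (+ n) (+ σ 1 n) (+ σ 3 n) (+ σ 5 n))
  , congruence 24 ((+ 10 , 1 , ₁) ∷ (+ 25 , 1 , ₇) ∷ (- + 11 , 1 , ₉) ∷ []) 600
    ((- + 1 , (0 , ₁) , (1 , ₇)) ∷ (+ 8 , (1 , ₁) , (0 , ₇)) ∷ []) refl n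
    (solve 4 (λ n s₁ s₇ s₉ → con (+ 10) :* n :* s₁ :+ con (+ 25) :* n :* s₇ :- con (+ 11) :* n :* s₉
        := con (+ 10) :* (n :^ 1 :* s₁) :+ (con (+ 25) :* (n :^ 1 :* s₇) :+ (con (- + 11) :* (n :^ 1 :* s₉) :+ con 0ℤ)))
      refl (+ n) (+ σ 1 n) (+ σ 7 n) (+ σ 9 n))
  , congruence 14 ((+ 9 , 2 , ₁) ∷ (+ 5 , 2 , ₇) ∷ []) 1512
    ((+ 1 , (1 , ₁) , (1 , ₅)) ∷ (- + 3 , (2 , ₁) , (0 , ₅)) ∷ []) refl n
    (solve 3 (λ n s₁ s₇ → con (+ 9) :* n :^ 2 :* s₁ :+ con (+ 5) :* n :^ 2 :* s₇
        := con (+ 9) :* (n :^ 2 :* s₁) :+ (con (+ 5) :* (n :^ 2 :* s₇) :+ con 0ℤ))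
      refl (+ n) (+ σ 1 n) (+ σ 7 n))
  , congruence 5 ((+ 8 , 3 , ₁) ∷ (- + 3 , 3 , ₅) ∷ []) 480
    ((- + 3 , (2 , ₁) , (1 , ₃)) ∷ (+ 4 , (3 , ₁) , (0 , ₃)) ∷ []) refl n
    (solve 3 (λ n s₁ s₅ → con (+ 8) :* n :^ 3 :* s₁ :- con (+ 3) :* n :^ 3 :* s₅
        := con (+ 8) :* (n :^ 3 :* s₁) :+ (con (- + 3) :* (n :^ 3 :* s₅) :+ con 0ℤ))
      refl (+ n) (+ σ 1 n) (+ σ 5 n))
  , congruence 2 ((+ 1 , 2 , ₁) ∷ (+ 1 , 2 , ₅) ∷ []) 24
    -- The outer products come from E₂ θ²S₅ and E₆ θ²S₁, where 504 = 21 · 24.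
    ((- + 1 , (0 , ₁) , (2 , ₅)) ∷ (+ 14 , (1 , ₁) , (1 , ₅)) ∷ (- + 21 , (2 , ₁) , (0 , ₅)) ∷ []) refl n
    (solve 3 (λ n s₁ s₅ → n :^ 2 :* s₁ :+ n :^ 2 :* s₅
        := con (+ 1) :* (n :^ 2 :* s₁) :+ (con (+ 1) :* (n :^ 2 :* s₅) :+ con 0ℤ))
      refl (+ n) (+ σ 1 n) (+ σ 5 n))
  where open +-*-Solver
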